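{- The problem Cops and Robber (input: a finite, simple, connected graph $G$ with at least one edge and an integer $k\in\mathbb{N}$; question: is $G$ $k$-copwin?), parameterized by the vertex cover number $\mathsf{vcn}$ of $G$, admits a kernel with at most $\mathsf{vcn} + \left\lceil\frac{2^{\mathsf{vcn}}}{\sqrt{\mathsf{vcn}}}\right\rceil$ vertices.
   Context: Cops and Robber game: two players with perfect information play on a graph $G$. The cop player places each of $k$ cops on a vertex (several cops may share a vertex); then the robber player places one robber on a vertex. Then they alternate moves, cops first. In a cop move, each cop either moves to an adjacent vertex or stays; in a robber move, the robber either moves to an adjacent vertex or stays. The cops win if they have a strategy to capture the robber (some cop occupies the same vertex as the robber) in finitely many moves. $G$ is $k$-copwin if $k$ cops have a winning strategy. The vertex cover number of $G$ is the minimum size of a set $U\subseteq V(G)$ such that $V(G)\setminus U$ is independent. A kernel for a parameterized problem is (the output of) a polynomial-time algorithm that maps each instance $I$ with parameter value $p$ to an equivalent instance $I'$ of the same problem (i.e. $I$ is a Yes-instance iff $I'$ is) whose size is bounded by a computable function of $p$. "A kernel with at most $f(p)$ vertices" means that the graph of $I'$ has at most $f(p)$ vertices, where $p$ is the parameter of the input instance. -}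

module Defs where

open import Data.Bool using (if_then_else_)
open import Data.Fin using (Fin)
open import Data.Fin.Properties using (all?)
open import Data.Fin.Subset using (Subset; _∈_; ∁; ∣_∣; ⊤)
open import Data.Fin.Subset.Properties using (_∈?_; anySubset?; x∈p⇒x∉∁p; ∈⊤)
open import Data.List using (List; []; _∷_; [_]; length; map; concatMap; applyUpTo; allFin)
open import Data.Nat using (ℕ; zero; suc; _+_; _*_; _∸_; _^_; _≤_; z≤n; s≤s; NonZero; _≟_; _≤?_)
open import Data.Nat.ListAction using (sum)
open import Data.Nat.Logarithm using (⌊log₂_⌋)
open import Data.Nat.Properties using (m≤m*n)
open import Data.Product using (∃; ∃-syntax; _×_; _,_; proj₁)
open import Function using (_∘_)
open import Function.Bundles using (_⇔_)
open import Level using (0ℓ)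
open import Relation.Binary using (Rel; Decidable; Symmetric; Irreflexive)
open import Relation.Binary.Construct.Closure.Reflexive using (ReflClosure)
open import Relation.Binary.Construct.Closure.ReflexiveTransitive using (Star)
open import Relation.Binary.PropositionalEquality using (_≡_; refl)
open import Relation.Nullary using (¬_; yes; no; does; ¬?; contradiction)
open import Relation.Nullary.Decidable using (_×-dec_; _→-dec_)
import Relation.Unary as U

------------------------------------------------------------------------
-- Least natural numbers

IsLeast : (ℕ → Set) → ℕ → Set
IsLeast P m = P m × (∀ j → P j → m ≤ j)

least : ∀ {P : ℕ → Set} → U.Decidable P → ∀ n → P n → ∃ (IsLeast P)
least P? zero    p = zero , p , λ _ _ → z≤n
least P? (suc n) p with P? zero
... | yes p₀ = zero , p₀ , λ _ _ → z≤n
... | no ¬p₀ with least (P? ∘ suc) n p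
...   | m , pm , min = suc m , pm , λ where
          zero    p₀ → contradiction p₀ ¬p₀
          (suc j) pj → s≤s (min j pj)

-- ⌈ a / √ b ⌉: for natural m and b ≥ 1, a / √b ≤ m iff a² ≤ m² b.

least-ceil : ∀ a b .{{_ : NonZero b}} → ∃ (IsLeast λ m → a * a ≤ m * m * b)
least-ceil a b = least (λ m → a * a ≤? m * m * b) a (m≤m*n (a * a) b)

⌈_/√_⌉ : (a b : ℕ) .{{_ : NonZero b}} → ℕ
⌈ a /√ b ⌉ = proj₁ (least-ceil a b)

-- p + ⌈ 2 ^ p / √ p ⌉. The value at 0 is irrelevant: a graph with an edge
-- has a positive vertex cover number.

kernelBound : ℕ → ℕ
kernelBound zero      = zero
kernelBound p@(suc _) = p + ⌈ 2 ^ p /√ p ⌉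

------------------------------------------------------------------------
-- Graphs

record Graph : Set₁ where
  field
    order  : ℕ
    Adj    : Rel (Fin order) 0ℓ
    Adj?   : Decidable Adj
    irrefl : Irreflexive _≡_ Adj
    symm   : Symmetric Adj

  Vertex : Set
  Vertex = Fin order

  Connected : Set
  Connected = ∀ u v → Star Adj u v

  HasEdge : Set
  HasEdge = ∃[ u ] ∃[ v ] Adj u v

  Independent : Subset order → Set
  Independent S = ∀ u v → u ∈ S → v ∈ S → ¬ Adj u v

  VertexCover : Subset order → Set
  VertexCover S = Independent (∁ S)

  HasVertexCover : ℕ → Set
  HasVertexCover m = ∃[ S ] VertexCover S × ∣ S ∣ ≡ m

  independent? : U.Decidable Independent
  independent? S = all? λ u → all? λ v →
    (u ∈? S) →-dec ((v ∈? S) →-dec ¬? (Adj? u v))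

  hasVertexCover? : U.Decidable HasVertexCover
  hasVertexCover? m = anySubset? λ S → independent? (∁ S) ×-dec (∣ S ∣ ≟ m)

  least-vcn : ∃ (IsLeast HasVertexCover)
  least-vcn = least hasVertexCover? ∣ ⊤ {order} ∣
    (⊤ , (λ u v u∈∁⊤ _ → contradiction u∈∁⊤ (x∈p⇒x∉∁p ∈⊤)) , refl)

  vcn : ℕ
  vcn = proj₁ least-vcn

------------------------------------------------------------------------
-- The Cops and Robber game

module Game (G : Graph) (k : ℕ) where
  open Graph G

  Cops : Set
  Cops = Fin k → Vertex

  Move : Rel Vertex 0ℓ
  Move = ReflClosure Adj

  Caught : Cops → Vertex → Set
  Caught c r = ∃[ i ] c i ≡ r

  -- Winning strategies for the cops as well-founded game trees, rooted at a
  -- position in which the cops, respectively the robber, are to move.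
  mutual
    data CopsToMove (c : Cops) (r : Vertex) : Set where
      caught : Caught c r → CopsToMove c r
      move   : ∀ c′ → (∀ i → Move (c i) (c′ i)) → RobberToMove c′ r → CopsToMove c r

    data RobberToMove (c : Cops) (r : Vertex) : Set where
      caught : Caught c r → RobberToMove c r
      move   : (∀ r′ → Move r r′ → CopsToMove c r′) → RobberToMove c r

  CopWin : Set
  CopWin = ∃[ c ] ∀ r → CopsToMove c r

------------------------------------------------------------------------
-- Random-access machines

-- Structured programs for a RAM with addition and truncated subtraction, but
-- no multiplication, at unit cost. A run of t steps lengthens the numbers
-- handled by at most O(t) bits, so time polynomial in the bit length of the
-- input is the same as on Turing machines (Cook and Reckhow).

Reg : Set
Reg = ℕ

infixr 5 _⨾_

data Program : Set where
  skip          : Program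
  const         : (x : Reg) (c : ℕ) → Program      -- x := c
  add           : (x y z : Reg) → Program          -- x := y + z
  sub           : (x y z : Reg) → Program          -- x := y ∸ z
  load          : (x y : Reg) → Program            -- x := mem[y]
  store         : (x y : Reg) → Program            -- mem[x] := y
  _⨾_           : (p q : Program) → Program
  ifPos         : (x : Reg) (p q : Program) → Program  -- if x > 0 then p else q
  whilePos      : (x : Reg) (p : Program) → Program    -- while x > 0 do p

record State : Set where
  constructor state
  field
    reg : Reg → ℕ
    mem : ℕ → ℕ

open State public

_[_≔_] : (ℕ → ℕ) → ℕ → ℕ → ℕ → ℕ
(f [ a ≔ v ]) b = if does (b ≟ a) then v else f b

setReg : State → Reg → ℕ → State
setReg s x v = state (reg s [ x ≔ v ]) (mem s)

setMem : State → ℕ → ℕ → State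
setMem s a v = state (reg s) (mem s [ a ≔ v ])

-- Run p s s′ t: started in s, the program p halts in s′ after t steps.
data Run : Program → State → State → ℕ → Set where
  skip  : ∀ {s} → Run skip s s 1
  const : ∀ {s x c} → Run (const x c) s (setReg s x c) 1
  add   : ∀ {s x y z} → Run (add x y z) s (setReg s x (reg s y + reg s z)) 1
  sub   : ∀ {s x y z} → Run (sub x y z) s (setReg s x (reg s y ∸ reg s z)) 1
  load  : ∀ {s x y} → Run (load x y) s (setReg s x (mem s (reg s y))) 1
  store : ∀ {s x y} → Run (store x y) s (setMem s (reg s x) (reg s y)) 1
  seq   : ∀ {s s′ s″ p q t u} → Run p s s′ t → Run q s′ s″ u →
          Run (p ⨾ q) s s″ (t + u)
  if-pos   : ∀ {s s′ x p q t n} → reg s x ≡ suc n → Run p s s′ t →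
             Run (ifPos x p q) s s′ (suc t)
  if-zero  : ∀ {s s′ x p q t} → reg s x ≡ 0 → Run q s s′ t →
             Run (ifPos x p q) s s′ (suc t)
  while-pos  : ∀ {s s′ s″ x p t u n} → reg s x ≡ suc n → Run p s s′ t →
               Run (whilePos x p) s′ s″ u →
               Run (whilePos x p) s s″ (suc (t + u))
  while-zero : ∀ {s x p} → reg s x ≡ 0 → Run (whilePos x p) s s 1

-- A word xs is held in memory cells 0, …, length xs ∸ 1, with its length in
-- register 0; all other registers and cells are initially 0.

Word : Set
Word = List ℕ

cells : Word → ℕ → ℕ
cells []       _       = 0
cells (x ∷ xs) zero    = x
cells (x ∷ xs) (suc i) = cells xs i

input : Word → State
input xs = state ((λ _ → 0) [ 0 ≔ length xs ]) (cells xs)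

output : State → Word
output s = applyUpTo (mem s) (reg s 0)

RunsTo : Program → Word → Word → ℕ → Set
RunsTo p xs ys t = ∃[ s ] Run p (input xs) s t × output s ≡ ys

bits : ℕ → ℕ
bits n = suc ⌊log₂ n ⌋

size : Word → ℕ
size xs = sum (map bits xs)

Computable : (ℕ → ℕ) → Set
Computable g = ∃[ p ] ∀ n → ∃[ t ] RunsTo p [ n ] [ g n ] t

PolyTime : ∀ {a b} {A : Set a} {B : Set b} → (A → Word) → (B → Word) → (A → B) → Set a
PolyTime encA encB f =
  ∃[ p ] ∃[ c ] ∃[ d ] ∀ x →
    ∃[ t ] RunsTo p (encA x) (encB (f x)) t × t ≤ c * size (encA x) ^ d + c

------------------------------------------------------------------------
-- Parameterized problems and kernels

record ParameterizedProblem : Set₂ where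
  field
    Instance  : Set₁
    encode    : Instance → Word
    parameter : Instance → ℕ
    Yes       : Instance → Set

record Kernel (P : ParameterizedProblem) : Set₁ where
  open ParameterizedProblem P
  field
    reduce     : Instance → Instance
    polyTime   : PolyTime encode encode reduce
    equivalent : ∀ I → Yes I ⇔ Yes (reduce I)
    bound      : ℕ → ℕ
    computable : Computable bound
    bounded    : ∀ I → size (encode (reduce I)) ≤ bound (parameter I)

------------------------------------------------------------------------
-- The problem Cops and Robber, parameterized by vertex cover number

record CopsInstance : Set₁ where
  field
    graph     : Graph
    connected : Graph.Connected graph
    hasEdge   : Graph.HasEdge graph
    k         : ℕ

  open Graph graph public

-- The number of vertices, then k, then the adjacency matrix row by row.
encodeCops : CopsInstance → Word
encodeCops I = order ∷ k ∷ concatMap (λ u → map (entry u) (allFin order)) (allFin order)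
  where
  open CopsInstance I
  entry : Vertex → Vertex → ℕ
  entry u v = if does (Adj? u v) then 1 else 0

CopsAndRobber : ParameterizedProblem
CopsAndRobber = record
  { Instance  = CopsInstance
  ; encode    = encodeCops
  ; parameter = CopsInstance.vcn
  ; Yes       = λ I → Game.CopWin (CopsInstance.graph I) (CopsInstance.k I)
  }

{-# OPTIONS --safe #-}
module Submission where

open import Defs
open import Algebra.Properties.CommutativeMonoid.Sum using ()
open import Data.Bool using (Bool; true; false; if_then_else_)
open import Data.Fin using (Fin; zero; suc; toℕ; fromℕ<; inject≤; combine; remQuot) renaming (_<_ to _<ᶠ_)
open import Data.Fin.Induction using (spo-noetherian)
open import Data.Fin.Properties using (any?; all?; ¬∀⟶∃¬; toℕ<n; toℕ-injective; toℕ-fromℕ<; toℕ-inject≤; toℕ-combine; combine-injective; remQuot-combine) renaming (_≟_ to _≟ᶠ_; <-cmp to <ᶠ-cmp; <-irrefl to <ᶠ-irrefl; <-trans to <ᶠ-trans; _<?_ to _<ᶠ?_)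
open import Data.Fin.Subset using (Subset; _∈_; _∉_; _⊆_; ∣_∣; _-_; inside; outside)
open import Data.Fin.Subset.Properties using (_∈?_; _⊆?_; ⊆-antisym; ⊆-trans; p⊆q⇒∣p∣≤∣q∣; p⊂q⇒∣p∣<∣q∣; ∣p∣≤n; drop-∷-⊆; x∈p∧x≢y⇒x∈p-y; x∉p⇒x∈∁p; p─⊥≡p)
open import Data.List using (List; []; _∷_; [_]; _++_; _∷ʳ_; length; map; concatMap; filter; lookup; tabulate; allFin; upTo; applyUpTo)
open import Data.List.Membership.Propositional using () renaming (_∈_ to _∈ˡ_)
open import Data.List.Membership.Propositional.Properties using (∈-allFin; ∈-filter⁺; ∈-filter⁻; ∈-lookup)
open import Data.List.Properties using (length-++; length-map; length-tabulate; map-tabulate; map-++; map-cong; map-∘; upTo-∷ʳ; filter-++; filter-accept; filter-reject; filter-≐; concatMap-++; concatMap-cong; concatMap-map; ++-identityʳ; ++-assoc; tabulate-lookup)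
open import Data.List.Relation.Unary.All as All using (All; []; _∷_)
open import Data.List.Relation.Unary.All.Properties using (concat⁺; map⁺)
open import Data.List.Relation.Unary.AllPairs using ([]; _∷_)
open import Data.List.Relation.Unary.Any using (index)
open import Data.List.Relation.Unary.Any.Properties using (lookup-index)
open import Data.List.Relation.Unary.Unique.Propositional using (Unique)
open import Data.List.Relation.Unary.Unique.Propositional.Properties using (filter⁺; allFin⁺)
open import Data.Nat hiding (∣_-_∣)
open import Data.Nat.Logarithm using (⌊log₂_⌋; ⌊log₂⌋-mono-≤; ⌊log₂[2^n]⌋≡n)
open import Data.Nat.Properties
open import Data.Nat.Tactic.RingSolver using (solve-∀)
open import Data.Product using (Σ; ∃; ∃₂; ∃-syntax; _×_; _,_; proj₁; proj₂; uncurry)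
open import Data.Sum using (_⊎_; inj₁; inj₂; [_,_]′)
open import Data.Unit using (⊤)
open import Data.Vec as Vec using (Vec; []; _∷_; here; there)
open import Data.Vec.Functional using (updateAt)
open import Data.Vec.Functional.Properties using (updateAt-updates; updateAt-minimal)
open import Data.Vec.Properties using ([]=⇒lookup; lookup⇒[]=; lookup∘tabulate)
open import Function using (_∘_; flip)
open import Function.Bundles using (_⇔_; mk⇔)
open import Function.Construct.Composition using (_⇔-∘_)
open import Induction.WellFounded using (Acc; acc)
open import Relation.Binary using (IsStrictPartialOrder; tri<; tri≈; tri>)
open import Relation.Binary.Construct.Closure.Reflexive using (ReflClosure; refl) renaming ([_] to along)
open import Relation.Binary.Construct.Closure.ReflexiveTransitive using (Star; ε; _◅_; gmap)
open import Relation.Binary.PropositionalEquality hiding ([_])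
open import Relation.Nullary using (Dec; does; yes; no; contradiction; ¬_; ¬?)
open import Relation.Nullary.Decidable using (map′; _×-dec_; _⊎-dec_; _→-dec_; dec-true; dec-false)
import Relation.Unary as U

-- For k ≥ 2, a vertex u may be deleted when another vertex v has N(u) ⊆ N(v): the graph retracts
-- onto the rest, and a cop standing on v pins a robber at u, since any move of the robber meets it,
-- while a second cop walks up. Keeping one vertex for every inclusion-maximal neighbourhood
-- leaves, outside a vertex cover of size p, an antichain of subsets of the cover, hence by Sperner's
-- theorem at most C(p, ⌊p/2⌋) ≤ 2 ^ p / √ p vertices. For k ≤ 1 the winner is computed by retrograde
-- analysis and a single edge is output. Both computations are written in a small language of loops
-- bounded by the number of vertices, so that running times are polynomial by construction.

-- Bounded loop programs and their compilation

-- With one cop the deletion of dominated vertices is unsound: opposite vertices of the 4-cycle have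
-- equal neighbourhoods, so a single edge is kept, and one cop wins on the edge but not on the
-- cycle. Hence the separate treatment of `k ≤ 1`. The output must contain an edge, so there the
-- computed answer is carried by the number of cops placed on one edge. The reduction never computes
-- a vertex cover; a minimum one enters only in the estimate of the order. All dominated vertices
-- are deleted at once, domination being judged in the input graph, which is sound because every
-- vertex has a dominator that is itself kept. A kernel must also bound the encoded size, and the
-- parameter does not bound `k`; the number of cops is therefore lowered to the order of the kept
-- graph, where a cop on every vertex wins anyway. Square roots and quotients are avoided
-- throughout: estimates are squared, and binomial coefficients occur only through factorials.

update-at : ∀ (f : ℕ → ℕ) a v → (f [ a ≔ v ]) a ≡ v
update-at f a v rewrite dec-true (a ≟ a) refl = refl

update-off : ∀ (f : ℕ → ℕ) {a v b} → b ≢ a → (f [ a ≔ v ]) b ≡ f b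
update-off f {a} {v} {b} b≢a rewrite dec-false (b ≟ a) b≢a = refl

update-cong : ∀ {f g : ℕ → ℕ} {a b v w} → f ≗ g → a ≡ b → v ≡ w → f [ a ≔ v ] ≗ g [ b ≔ w ]
update-cong {a = a} {v = v} f≗g refl refl x = cong (if does (x ≟ a) then v else_) (f≗g x)

sumTo : ℕ → (ℕ → ℕ) → ℕ
sumTo zero    f = 0
sumTo (suc n) f = f n + sumTo n f

iter : ∀ {A : Set} → ℕ → (ℕ → A → A) → A → A
iter zero    f x = x
iter (suc n) f x = f n (iter n f x)

-- A language of loops bounded by a global size N, in which only the memory is
-- mutable; variables are bound by ∑ and for and range over 0, …, N ∸ 1.

infixl 6 _⊕_ _⊖_
infix  5 _:=_
infixr 4 _⨟_

data Expr (n : ℕ) : Set where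
  var     : Fin n → Expr n
  lit     : ℕ → Expr n
  _⊕_ _⊖_ : Expr n → Expr n → Expr n
  cell    : Expr n → Expr n
  ∑       : Expr (suc n) → Expr n

data Stmt (n : ℕ) : Set where
  _:=_   : Expr n → Expr n → Stmt n
  _⨟_    : Stmt n → Stmt n → Stmt n
  choose : Expr n → Stmt n → Stmt n → Stmt n
  for    : Stmt (suc n) → Stmt n

Memory : Set
Memory = ℕ → ℕ

if⁺_then_else_ : ∀ {a} {A : Set a} → ℕ → A → A → A
if⁺ zero  then x else y = y
if⁺ suc _ then x else y = x

module _ (N : ℕ) where

  eval : ∀ {n} → Vec ℕ n → Memory → Expr n → ℕ
  eval ρ m (var i)  = Vec.lookup ρ i
  eval ρ m (lit c)  = c
  eval ρ m (e ⊕ f)  = eval ρ m e + eval ρ m f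
  eval ρ m (e ⊖ f)  = eval ρ m e ∸ eval ρ m f
  eval ρ m (cell e) = m (eval ρ m e)
  eval ρ m (∑ e)    = sumTo N λ i → eval (i ∷ ρ) m e

  exec : ∀ {n} → Vec ℕ n → Stmt n → Memory → Memory
  exec ρ (e := f)       m = m [ eval ρ m e ≔ eval ρ m f ]
  exec ρ (p ⨟ q)        m = exec ρ q (exec ρ p m)
  exec ρ (choose e p q) m = if⁺ eval ρ m e then exec ρ p m else exec ρ q m
  exec ρ (for p)        m = iter N (λ i → exec (i ∷ ρ) p) m

-- Register 0 holds N. A fragment compiled at t uses the registers from t on as
-- scratch space and leaves the value of an expression in t.

-- The counter in `1 + t` is decremented before the body and serves as the bound variable, so a sum
-- runs downwards, as `sumTo` does. Register `2 + t` holds the constant 1 only until the body leaves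
-- its value there.
sumBody : Reg → Program → Program
sumBody t p = const (2 + t) 1 ⨾ sub (1 + t) (1 + t) (2 + t) ⨾ p ⨾ add t t (2 + t)

-- For statements the order of execution matters: the index in `t` counts upwards, as in `iter`,
-- while `1 + t` counts the rounds that are left.
forBody : Reg → Program → Program
forBody t p = p ⨾ const (2 + t) 1 ⨾ add t t (2 + t) ⨾ sub (1 + t) (1 + t) (2 + t)

compileExpr : ∀ {n} → Reg → Vec Reg n → Expr n → Program
compileExpr t Γ (var i)  = const t 0 ⨾ add t (Vec.lookup Γ i) t
compileExpr t Γ (lit c)  = const t c
compileExpr t Γ (e ⊕ f)  = compileExpr t Γ e ⨾ compileExpr (1 + t) Γ f ⨾ add t t (1 + t)
compileExpr t Γ (e ⊖ f)  = compileExpr t Γ e ⨾ compileExpr (1 + t) Γ f ⨾ sub t t (1 + t)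
compileExpr t Γ (cell e) = compileExpr t Γ e ⨾ load t t
compileExpr t Γ (∑ e)    =
  -- As `t` is zero, the addition copies `N` from register 0 into the counter.
  const t 0 ⨾ add (1 + t) 0 t ⨾
  whilePos (1 + t) (sumBody t (compileExpr (2 + t) (1 + t ∷ Γ) e))

compileStmt : ∀ {n} → Reg → Vec Reg n → Stmt n → Program
compileStmt t Γ (e := f)       = compileExpr t Γ e ⨾ compileExpr (1 + t) Γ f ⨾ store t (1 + t)
compileStmt t Γ (p ⨟ q)        = compileStmt t Γ p ⨾ compileStmt t Γ q
compileStmt t Γ (choose e p q) =
  compileExpr t Γ e ⨾ ifPos t (compileStmt t Γ p) (compileStmt t Γ q)
compileStmt t Γ (for p)        =
  const t 0 ⨾ add (1 + t) 0 t ⨾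
  whilePos (1 + t) (forBody t (compileStmt (2 + t) (t ∷ Γ) p))

loopCost : ℕ → ℕ → ℕ
loopCost b zero    = 1
loopCost b (suc c) = suc (b + loopCost b c)

-- This is the exact number of steps, since expressions do not branch. For statements there is only
-- an upper bound, because `choose` is charged for both branches.
costExpr : ∀ {n} → ℕ → Expr n → ℕ
costExpr N (var i)  = 2
costExpr N (lit c)  = 1
costExpr N (e ⊕ f)  = costExpr N e + (costExpr N f + 1)
costExpr N (e ⊖ f)  = costExpr N e + (costExpr N f + 1)
costExpr N (cell e) = costExpr N e + 1
costExpr N (∑ e)    = 1 + (1 + loopCost (1 + (1 + (costExpr N e + 1))) N)

costStmt : ∀ {n} → ℕ → Stmt n → ℕ
costStmt N (e := f)       = costExpr N e + (costExpr N f + 1)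
costStmt N (p ⨟ q)        = costStmt N p + costStmt N q
costStmt N (choose e p q) = costExpr N e + suc (costStmt N p + costStmt N q)
costStmt N (for p)        = 1 + (1 + loopCost (costStmt N p + 3) N)

-- Correctness and cost of compiled programs

record Represents (N : ℕ) {n} (t : Reg) (Γ : Vec Reg n) (ρ : Vec ℕ n) (m : Memory) (s : State) : Set where
  constructor represents
  field
    positive : 0 < t
    size-reg : reg s 0 ≡ N
    fresh    : ∀ i → Vec.lookup Γ i < t
    vars     : ∀ i → reg s (Vec.lookup Γ i) ≡ Vec.lookup ρ i
    memory   : mem s ≗ m

open Represents

-- The frame condition of a fragment compiled at `t`: `N` and the bound variables live in registers
-- below `t` and survive it.
record _≈[_]_ (s : State) (t : Reg) (s′ : State) : Set where
  constructor agree
  field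
    on : ∀ x → x < t → reg s′ x ≡ reg s x

open _≈[_]_

≈-set : ∀ {s s′ t} x v → t ≤ x → s ≈[ t ] s′ → s ≈[ t ] setReg s′ x v
≈-set {s′ = s′} x v t≤x eq = agree λ y y<t →
  trans (update-off (reg s′) (<⇒≢ (<-≤-trans y<t t≤x))) (on eq y y<t)

≈-refl : ∀ {s t} → s ≈[ t ] s
≈-refl = agree λ _ _ → refl

≈-trans : ∀ {s s′ s″ t} → s ≈[ t ] s′ → s′ ≈[ t ] s″ → s ≈[ t ] s″
≈-trans p q = agree λ x x<t → trans (on q x x<t) (on p x x<t)

≈-weaken : ∀ {s s′ t u} → t ≤ u → s ≈[ u ] s′ → s ≈[ t ] s′
≈-weaken t≤u p = agree λ x x<t → on p x (<-≤-trans x<t t≤u)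

transport : ∀ {N n t} {Γ : Vec Reg n} {ρ m m′ s s′} → Represents N t Γ ρ m s →
            s ≈[ t ] s′ → mem s′ ≗ m′ → Represents N t Γ ρ m′ s′
transport {Γ = Γ} r eq mm = represents (positive r)
  (trans (on eq 0 (positive r)) (size-reg r)) (fresh r)
  (λ i → trans (on eq _ (fresh r i)) (vars r i)) mm

raise : ∀ {N n t u} {Γ : Vec Reg n} {ρ m s} → t ≤ u → Represents N t Γ ρ m s → Represents N u Γ ρ m s
raise t≤u r = represents (<-≤-trans (positive r) t≤u) (size-reg r)
  (λ i → <-≤-trans (fresh r i) t≤u) (vars r) (memory r)

bind : ∀ {N n t} {Γ : Vec Reg n} {ρ m s} x v → x < t → reg s x ≡ v →
       Represents N t Γ ρ m s → Represents N t (x ∷ Γ) (v ∷ ρ) m s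
bind x v x<t eq r = represents (positive r) (size-reg r)
  (λ { zero → x<t ; (suc i) → fresh r i }) (λ { zero → eq ; (suc i) → vars r i }) (memory r)

t≢1+t : ∀ t → t ≢ 1 + t
t≢1+t t = <⇒≢ (n<1+n t)

t≢2+t : ∀ t → t ≢ 2 + t
t≢2+t t = <⇒≢ (m≤n+m (suc t) 1)

EvalResult : ℕ → State → Reg → Program → Memory → ℕ → ℕ → Set
EvalResult N s t p m v c =
  ∃[ s′ ] Run p s s′ c × reg s′ t ≡ v × s ≈[ t ] s′ × mem s′ ≗ m

-- The loop invariant: `a` has been accumulated, and the terms with indices below `c` are still to
-- be added.
sumLoop : ∀ {N n t} {Γ : Vec Reg n} {ρ m p b} (f : ℕ → ℕ) →
  (∀ i {s} → Represents N (2 + t) (1 + t ∷ Γ) (i ∷ ρ) m s → EvalResult N s (2 + t) p m (f i) b) →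
  ∀ c a s → Represents N t Γ ρ m s → reg s (1 + t) ≡ c → reg s t ≡ a →
  EvalResult N s t (whilePos (1 + t) (sumBody t p)) m (sumTo c f + a) (loopCost (1 + (1 + (b + 1))) c)
sumLoop f body zero a s r eqc eqa = s , while-zero eqc , eqa , ≈-refl , memory r
sumLoop {N} {t = t} {Γ} {ρ} {m} f body (suc c) a s r eqc eqa =
  let s₁ = setReg s (2 + t) 1
      v₂ = reg s₁ (1 + t) ∸ reg s₁ (2 + t)
      s₂ = setReg s₁ (1 + t) v₂
      v₂≡c : v₂ ≡ c
      v₂≡c = cong₂ _∸_ (trans (update-off (reg s) (t≢1+t (1 + t))) eqc) (update-at (reg s) (2 + t) 1)
      s≈s₂ : s ≈[ t ] s₂
      s≈s₂ = ≈-set (1 + t) v₂ (n≤1+n t) (≈-set (2 + t) 1 (m≤n+m t 2) ≈-refl)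
      r₂ : Represents N t Γ ρ m s₂
      r₂ = transport r s≈s₂ (memory r)
      s₃ , run₃ , val₃ , s₂≈s₃ , mem₃ = body c
        (bind (1 + t) c (n<1+n _) (trans (update-at (reg s₁) (1 + t) v₂) v₂≡c) (raise (m≤n+m t 2) r₂))
      v₄ = reg s₃ t + reg s₃ (2 + t)
      s₄ = setReg s₃ t v₄
      s≈s₄ : s ≈[ t ] s₄
      s≈s₄ = ≈-set t v₄ ≤-refl (≈-trans s≈s₂ (≈-weaken (m≤n+m t 2) s₂≈s₃))
      old₃ : reg s₃ t ≡ a
      old₃ = trans (on s₂≈s₃ t (m≤n+m _ 1))
        (trans (update-off (reg s₁) (t≢1+t t)) (trans (update-off (reg s) (t≢2+t t)) eqa))
      acc : reg s₄ t ≡ a + f c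
      acc = trans (update-at (reg s₃) t v₄) (cong₂ _+_ old₃ val₃)
      cnt : reg s₄ (1 + t) ≡ c
      cnt = trans (update-off (reg s₃) (≢-sym (t≢1+t t)))
        (trans (on s₂≈s₃ (1 + t) (n<1+n _)) (trans (update-at (reg s₁) (1 + t) v₂) v₂≡c))
      s₅ , run₅ , val₅ , s₄≈s₅ , mem₅ = sumLoop f body c (a + f c) s₄ (transport r s≈s₄ mem₃) cnt acc
  in s₅ , while-pos eqc (seq const (seq sub (seq run₃ add))) run₅ ,
     trans val₅ (trans (cong (sumTo c f +_) (+-comm a (f c)))
       (trans (sym (+-assoc (sumTo c f) (f c) a)) (cong (_+ a) (+-comm (sumTo c f) (f c))))) ,
     ≈-trans s≈s₄ s₄≈s₅ , mem₅

binary : ∀ {N n t} {Γ : Vec Reg n} {ρ m s p q v w c d} → Represents N t Γ ρ m s →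
  EvalResult N s t p m v c →
  (∀ {s′} → Represents N (1 + t) Γ ρ m s′ → EvalResult N s′ (1 + t) q m w d) →
  ∃₂ λ s₁ s₂ → Run p s s₁ c × Run q s₁ s₂ d ×
    reg s₂ t ≡ v × reg s₂ (1 + t) ≡ w × s ≈[ t ] s₂ × mem s₂ ≗ m
binary {t = t} {s = s} r (s₁ , run₁ , val₁ , eq₁ , mem₁) second =
  let s₂ , run₂ , val₂ , eq₂ , mem₂ = second (raise (n≤1+n t) (transport r eq₁ mem₁))
  in s₁ , s₂ , run₁ , run₂ , trans (on eq₂ t (n<1+n t)) val₁ , val₂ ,
     ≈-trans eq₁ (≈-weaken (n≤1+n t) eq₂) , mem₂

compileExpr-correct : ∀ {N n t} {Γ : Vec Reg n} {ρ m s} (e : Expr n) → Represents N t Γ ρ m s →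
  EvalResult N s t (compileExpr t Γ e) m (eval N ρ m e) (costExpr N e)
compileExpr-correct {t = t} {Γ} {s = s} (var i) r =
  let s₁ = setReg s t 0 in
  _ , seq const add ,
  trans (update-at (reg s₁) t _)
    (trans (cong₂ _+_ (trans (update-off (reg s) (<⇒≢ (fresh r i))) (vars r i)) (update-at (reg s) t 0))
      (+-identityʳ _)) ,
  ≈-set t _ ≤-refl (≈-set t 0 ≤-refl ≈-refl) , memory r
compileExpr-correct {t = t} {s = s} (lit c) r =
  _ , const , update-at (reg s) t c , ≈-set t c ≤-refl ≈-refl , memory r
compileExpr-correct {t = t} (e ⊕ f) r =
  let s₁ , s₂ , run₁ , run₂ , val₁ , val₂ , eq₂ , mem₂ =
        binary r (compileExpr-correct e r) (compileExpr-correct f)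
  in _ , seq run₁ (seq run₂ add) , trans (update-at (reg s₂) t _) (cong₂ _+_ val₁ val₂) ,
     ≈-set t _ ≤-refl eq₂ , mem₂
compileExpr-correct {t = t} (e ⊖ f) r =
  let s₁ , s₂ , run₁ , run₂ , val₁ , val₂ , eq₂ , mem₂ =
        binary r (compileExpr-correct e r) (compileExpr-correct f)
  in _ , seq run₁ (seq run₂ sub) , trans (update-at (reg s₂) t _) (cong₂ _∸_ val₁ val₂) ,
     ≈-set t _ ≤-refl eq₂ , mem₂
compileExpr-correct {t = t} {m = m} (cell e) r =
  let s₁ , run₁ , val₁ , eq₁ , mem₁ = compileExpr-correct e r
  in _ , seq run₁ load , trans (update-at (reg s₁) t _) (trans (mem₁ _) (cong m val₁)) ,
     ≈-set t _ ≤-refl eq₁ , mem₁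
compileExpr-correct {N} {t = t} {Γ} {ρ} {m} {s} (∑ e) r =
  let s₁ = setReg s t 0
      v  = reg s₁ 0 + reg s₁ t
      s₂ = setReg s₁ (1 + t) v
      s≈s₂ : s ≈[ t ] s₂
      s≈s₂ = ≈-set (1 + t) v (n≤1+n t) (≈-set t 0 ≤-refl ≈-refl)
      v≡N : v ≡ N
      v≡N = trans (cong₂ _+_ (trans (update-off (reg s) (<⇒≢ (positive r))) (size-reg r))
              (update-at (reg s) t 0)) (+-identityʳ N)
      s₃ , run₃ , val₃ , s₂≈s₃ , mem₃ =
        sumLoop (λ i → eval N (i ∷ ρ) m e) (λ i → compileExpr-correct e) N 0 s₂
          (transport r s≈s₂ (memory r)) (trans (update-at (reg s₁) (1 + t) v) v≡N)
          (trans (update-off (reg s₁) (t≢1+t t)) (update-at (reg s) t 0))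
  in s₃ , seq const (seq add run₃) , trans val₃ (+-identityʳ _) ,
     ≈-trans s≈s₂ s₂≈s₃ , mem₃

ExecResult : ℕ → State → Reg → Program → Memory → ℕ → Set
ExecResult N s t p m c =
  ∃₂ λ s′ c′ → Run p s s′ c′ × c′ ≤ c × s ≈[ t ] s′ × mem s′ ≗ m

-- The loop invariant: `i` rounds are done, `c` are left, and the memory is that after `i`
-- iterations; at `c = 0` the equation `i + c ≡ N` turns this into the final memory.
forLoop : ∀ {N n t} {Γ : Vec Reg n} {ρ p b} (f : ℕ → Memory → Memory) m →
  (∀ i {m s} → Represents N (2 + t) (t ∷ Γ) (i ∷ ρ) m s → ExecResult N s (2 + t) p (f i m) b) →
  ∀ c i s → i + c ≡ N → Represents N t Γ ρ (iter i f m) s → reg s (1 + t) ≡ c → reg s t ≡ i →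
  ExecResult N s t (whilePos (1 + t) (forBody t p)) (iter N f m) (loopCost (b + 3) c)
forLoop f m body zero i s refl r eqc eqi =
  s , 1 , while-zero eqc , ≤-refl , ≈-refl ,
  λ a → trans (memory r a) (cong (λ k → iter k f m a) (sym (+-identityʳ i)))
forLoop {N} {t = t} {Γ} {ρ} {p} {b} f m body (suc c) i s i+c r eqc eqi =
  let s₁ , c₁ , run₁ , le₁ , s≈s₁ , mem₁ =
        body i (bind t i (m≤n+m _ 1) eqi (raise (m≤n+m t 2) r))
      s₂ = setReg s₁ (2 + t) 1
      v₃ = reg s₂ t + reg s₂ (2 + t)
      s₃ = setReg s₂ t v₃
      v₄ = reg s₃ (1 + t) ∸ reg s₃ (2 + t)
      s₄ = setReg s₃ (1 + t) v₄
      s≈s₄ : s ≈[ t ] s₄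
      s≈s₄ = ≈-set (1 + t) v₄ (n≤1+n t) (≈-set t v₃ ≤-refl (≈-set (2 + t) 1 (m≤n+m t 2)
        (≈-weaken (m≤n+m t 2) s≈s₁)))
      v₃≡ : v₃ ≡ suc i
      v₃≡ = trans (cong₂ _+_ (trans (update-off (reg s₁) (t≢2+t t)) (trans (on s≈s₁ t (m≤n+m _ 1)) eqi))
              (update-at (reg s₁) (2 + t) 1)) (+-comm i 1)
      v₄≡ : v₄ ≡ c
      v₄≡ = cong₂ _∸_
        (trans (update-off (reg s₂) (≢-sym (t≢1+t t))) (trans (update-off (reg s₁) (t≢1+t (1 + t)))
          (trans (on s≈s₁ (1 + t) (n<1+n _)) eqc)))
        (trans (update-off (reg s₂) (≢-sym (t≢2+t t))) (update-at (reg s₁) (2 + t) 1))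
      s₅ , c₅ , run₅ , le₅ , s₄≈s₅ , mem₅ =
        forLoop {b = b} f m body c (suc i) s₄ (trans (sym (+-suc i c)) i+c)
          (transport r s≈s₄ mem₁)
          (trans (update-at (reg s₃) (1 + t) v₄) v₄≡)
          (trans (update-off (reg s₃) (t≢1+t t)) (trans (update-at (reg s₂) t v₃) v₃≡))
  in s₅ , _ , while-pos eqc (seq run₁ (seq const (seq add sub))) run₅ ,
     s≤s (+-mono-≤ (+-monoˡ-≤ 3 le₁) le₅) , ≈-trans s≈s₄ s₄≈s₅ , mem₅

compileStmt-correct : ∀ {N n t} {Γ : Vec Reg n} {ρ m s} (p : Stmt n) → Represents N t Γ ρ m s →
  ExecResult N s t (compileStmt t Γ p) (exec N ρ p m) (costStmt N p)
compileStmt-correct (e := f) r =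
  let s₁ , s₂ , run₁ , run₂ , val₁ , val₂ , eq₂ , mem₂ =
        binary r (compileExpr-correct e r) (compileExpr-correct f)
  in _ , _ , seq run₁ (seq run₂ store) , ≤-refl , agree (on eq₂) , update-cong mem₂ val₁ val₂
compileStmt-correct {s = s} (p ⨟ q) r =
  let s₁ , _ , run₁ , le₁ , eq₁ , mem₁ = compileStmt-correct p r
      s₂ , _ , run₂ , le₂ , eq₂ , mem₂ = compileStmt-correct q (transport r eq₁ mem₁)
  in s₂ , _ , seq run₁ run₂ , +-mono-≤ le₁ le₂ , ≈-trans eq₁ eq₂ , mem₂
compileStmt-correct {N} {ρ = ρ} {m} {s} (choose e p q) r
  with s₁ , run₁ , val₁ , eq₁ , mem₁ ← compileExpr-correct e r | eval N ρ m e
... | zero  =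
  let s₂ , _ , run₂ , le₂ , eq₂ , mem₂ = compileStmt-correct q (transport r eq₁ mem₁)
  in s₂ , _ , seq run₁ (if-zero val₁ run₂) ,
     +-monoʳ-≤ (costExpr N e) (s≤s (m≤n⇒m≤o+n (costStmt N p) le₂)) , ≈-trans eq₁ eq₂ , mem₂
... | suc _ =
  let s₂ , _ , run₂ , le₂ , eq₂ , mem₂ = compileStmt-correct p (transport r eq₁ mem₁)
  in s₂ , _ , seq run₁ (if-pos val₁ run₂) ,
     +-monoʳ-≤ (costExpr N e) (s≤s (m≤n⇒m≤n+o (costStmt N q) le₂)) , ≈-trans eq₁ eq₂ , mem₂
compileStmt-correct {N} {t = t} {Γ} {ρ} {m} {s} (for p) r =
  let s₁ = setReg s t 0
      v  = reg s₁ 0 + reg s₁ t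
      s₂ = setReg s₁ (1 + t) v
      s≈s₂ : s ≈[ t ] s₂
      s≈s₂ = ≈-set (1 + t) v (n≤1+n t) (≈-set t 0 ≤-refl ≈-refl)
      v≡N : v ≡ N
      v≡N = trans (cong₂ _+_ (trans (update-off (reg s) (<⇒≢ (positive r))) (size-reg r))
              (update-at (reg s) t 0)) (+-identityʳ N)
      s₃ , _ , run₃ , le₃ , s₂≈s₃ , mem₃ =
        forLoop {b = costStmt N p} (λ i → exec N (i ∷ ρ) p) m (λ i → compileStmt-correct p) N 0 s₂ refl
          (transport r s≈s₂ (memory r)) (trans (update-at (reg s₁) (1 + t) v) v≡N)
          (trans (update-off (reg s₁) (t≢1+t t)) (update-at (reg s) t 0))
  in s₃ , _ , seq const (seq add run₃) , s≤s (s≤s le₃) , ≈-trans s≈s₂ s₂≈s₃ , mem₃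

-- The size N is the first letter of the input word; e computes the length of the output.
compile : Stmt 0 → Expr 0 → Program
compile p e = load 0 1 ⨾ compileStmt 1 [] p ⨾ compileExpr 1 [] e ⨾ const 2 0 ⨾ add 0 1 2

cost : Stmt 0 → Expr 0 → ℕ → ℕ
cost p e N = 1 + (costStmt N p + (costExpr N e + 2))

applyUpTo-cong : ∀ {A : Set} {f g : ℕ → A} n → (∀ i → i < n → f i ≡ g i) → applyUpTo f n ≡ applyUpTo g n
applyUpTo-cong zero    eq = refl
applyUpTo-cong (suc n) eq = cong₂ _∷_ (eq 0 z<s) (applyUpTo-cong n (λ i i<n → eq (suc i) (s<s i<n)))

applyUpTo-cells : ∀ xs → applyUpTo (cells xs) (length xs) ≡ xs
applyUpTo-cells []       = refl
applyUpTo-cells (x ∷ xs) = cong (x ∷_) (applyUpTo-cells xs)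

compile-correct : ∀ p e xs ys → let N = cells xs 0; m = exec N [] p (cells xs) in
  eval N [] m e ≡ length ys → (∀ i → i < length ys → m i ≡ cells ys i) →
  ∃[ t ] RunsTo (compile p e) xs ys t × t ≤ cost p e N
compile-correct p e xs ys len eq =
  let N = cells xs 0
      -- Register 1 is still 0, so the initial `load` fetches cell 0 and replaces the length of the
      -- word in register 0 by `N`.
      s₀ = setReg (input xs) 0 N
      s₁ , _ , run₁ , le₁ , eq₁ , mem₁ = compileStmt-correct {N} {t = 1} {[]} {[]} {cells xs} {s₀} p
        (represents z<s refl (λ ()) (λ ()) (λ _ → refl))
      s₂ , run₂ , val₂ , eq₂ , mem₂ = compileExpr-correct {N} {t = 1} {[]} {[]} e
        (represents z<s (on eq₁ 0 z<s) (λ ()) (λ ()) mem₁)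
      length≡ : reg s₂ 1 + 0 ≡ length ys
      length≡ = trans (+-identityʳ _) (trans val₂ len)
  in _ , (_ , seq load (seq run₁ (seq run₂ (seq const add))) ,
       trans (cong (applyUpTo (mem s₂)) length≡)
         (trans (applyUpTo-cong (length ys) (λ i i< → trans (mem₂ i) (eq i i<))) (applyUpTo-cells ys))) ,
     s≤s (+-monoˡ-≤ _ le₁)

-- Polynomial running times

Polynomial : (ℕ → ℕ) → Set
Polynomial f = ∃₂ λ c d → ∀ N → f N ≤ c * suc N ^ d

1≤[1+N]^d : ∀ N d → 1 ≤ suc N ^ d
1≤[1+N]^d N d = m^n>0 (suc N) d

polynomial-const : ∀ k → Polynomial λ _ → k
polynomial-const k = k , 0 , λ N → ≤-reflexive (sym (*-identityʳ k))

polynomial-+ : ∀ {f g} → Polynomial f → Polynomial g → Polynomial λ N → f N + g N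
polynomial-+ (c , d , p) (c′ , d′ , p′) = c + c′ , d + d′ , λ N →
  ≤-trans (+-mono-≤
    (≤-trans (p N) (*-monoʳ-≤ c (^-monoʳ-≤ (suc N) (m≤m+n d d′))))
    (≤-trans (p′ N) (*-monoʳ-≤ c′ (^-monoʳ-≤ (suc N) (m≤n+m d′ d)))))
    (≤-reflexive (sym (*-distribʳ-+ (suc N ^ (d + d′)) c c′)))

-- At most `N + 1` times the cost of one round and its test, so a loop raises the degree by one.
polynomial-loop : ∀ {f} → Polynomial f → Polynomial λ N → loopCost (f N) N
polynomial-loop {f} (c , d , p) = suc c , suc d , λ N → begin
  loopCost (f N) N                         ≤⟨ loop N N ⟩
  suc N * suc (f N)                        ≤⟨ *-monoʳ-≤ (suc N) (s≤s (p N)) ⟩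
  suc N * suc (c * suc N ^ d)              ≤⟨ *-monoʳ-≤ (suc N) (+-monoˡ-≤ (c * suc N ^ d) (1≤[1+N]^d N d)) ⟩
  suc N * (suc c * suc N ^ d)              ≡⟨ *-assoc (suc N) (suc c) _ ⟨
  suc N * suc c * suc N ^ d                ≡⟨ cong (_* suc N ^ d) (*-comm (suc N) (suc c)) ⟩
  suc c * suc N * suc N ^ d                ≡⟨ *-assoc (suc c) (suc N) _ ⟩
  suc c * suc N ^ suc d                    ∎
  where
  open ≤-Reasoning
  loop : ∀ N k → loopCost (f N) k ≤ suc k * suc (f N)
  loop N zero    = s≤s z≤n
  loop N (suc k) = +-monoʳ-≤ (suc (f N)) (loop N k)

costExpr-polynomial : ∀ {n} (e : Expr n) → Polynomial λ N → costExpr N e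
costExpr-polynomial (var i)  = polynomial-const 2
costExpr-polynomial (lit c)  = polynomial-const 1
costExpr-polynomial (e ⊕ f)  =
  polynomial-+ (costExpr-polynomial e) (polynomial-+ (costExpr-polynomial f) (polynomial-const 1))
costExpr-polynomial (e ⊖ f)  =
  polynomial-+ (costExpr-polynomial e) (polynomial-+ (costExpr-polynomial f) (polynomial-const 1))
costExpr-polynomial (cell e) = polynomial-+ (costExpr-polynomial e) (polynomial-const 1)
costExpr-polynomial (∑ e)    = polynomial-+ (polynomial-const 2) (polynomial-loop
  (polynomial-+ (polynomial-const 2) (polynomial-+ (costExpr-polynomial e) (polynomial-const 1))))

costStmt-polynomial : ∀ {n} (p : Stmt n) → Polynomial λ N → costStmt N p
costStmt-polynomial (e := f)       =
  polynomial-+ (costExpr-polynomial e) (polynomial-+ (costExpr-polynomial f) (polynomial-const 1))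
costStmt-polynomial (p ⨟ q)        = polynomial-+ (costStmt-polynomial p) (costStmt-polynomial q)
costStmt-polynomial (choose e p q) = polynomial-+ (costExpr-polynomial e)
  (polynomial-+ (polynomial-const 1) (polynomial-+ (costStmt-polynomial p) (costStmt-polynomial q)))
costStmt-polynomial (for p)        = polynomial-+ (polynomial-const 2) (polynomial-loop
  (polynomial-+ (costStmt-polynomial p) (polynomial-const 3)))

cost-polynomial : ∀ p e → Polynomial (cost p e)
cost-polynomial p e = polynomial-+ (polynomial-const 1) (polynomial-+ (costStmt-polynomial p)
  (polynomial-+ (costExpr-polynomial e) (polynomial-const 2)))

-- Constant and degree depend on the program alone. As `N` is less than the input size, the base
-- `suc N` of the cost bound, which is positive even for `N = 0`, is at most that size.
polyTime : ∀ {a b} {A : Set a} {B : Set b} {encA : A → Word} {encB : B → Word} {f : A → B} p e →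
  (∀ x → let N = cells (encA x) 0; m = exec N [] p (cells (encA x)); ys = encB (f x) in
         N < size (encA x) × eval N [] m e ≡ length ys × (∀ i → i < length ys → m i ≡ cells ys i)) →
  PolyTime encA encB f
polyTime {encA = encA} {encB} {f} p e correct = let c , d , poly = cost-polynomial p e in
  compile p e , c , d , λ x →
  let N<size , length≡ , cells≡ = correct x
      t , run , t≤ = compile-correct p e (encA x) (encB (f x)) length≡ cells≡
  in t , run , ≤-trans t≤ (≤-trans (poly (cells (encA x) 0))
       (≤-trans (*-monoʳ-≤ c (^-monoˡ-≤ d N<size)) (m≤m+n _ c)))

-- Sperner's theorem

open Algebra.Properties.CommutativeMonoid.Sum +-0-commutativeMonoid
  using (sum; sum-cong-≗; ∑-comm; sum-replicate-zero)

subset : ∀ {n} {P : Fin n → Set} → U.Decidable P → Subset n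
subset P? = Vec.tabulate (does ∘ P?)

∈-subset⁺ : ∀ {n} {P : Fin n → Set} (P? : U.Decidable P) {x} → P x → x ∈ subset P?
∈-subset⁺ P? {x} px = lookup⇒[]= x _ (trans (lookup∘tabulate _ x) (dec-true (P? x) px))

∈-subset⁻ : ∀ {n} {P : Fin n → Set} (P? : U.Decidable P) {x} → x ∈ subset P? → P x
∈-subset⁻ P? {x} x∈ with P? x | trans (sym (lookup∘tabulate (does ∘ P?) x)) ([]=⇒lookup x∈)
... | yes px | _ = px

when : Bool → ℕ → ℕ
when b k = if b then k else 0

sum-mono : ∀ {n} {f g : Fin n → ℕ} → (∀ i → f i ≤ g i) → sum f ≤ sum g
sum-mono {zero}  le = z≤n
sum-mono {suc n} le = +-mono-≤ (le zero) (sum-mono (le ∘ suc))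

sum-zero : ∀ {n} {f : Fin n → ℕ} → (∀ i → f i ≡ 0) → sum f ≡ 0
sum-zero {n} f≡0 = trans (sum-cong-≗ f≡0) (sum-replicate-zero n)

sum-single : ∀ {n} {f : Fin n → ℕ} i → (∀ j → j ≢ i → f j ≡ 0) → sum f ≡ f i
sum-single {suc n} {f} zero    eq =
  trans (cong (f zero +_) (sum-zero λ j → eq (suc j) λ ())) (+-identityʳ _)
sum-single {suc n} {f} (suc i) eq =
  cong₂ _+_ (eq zero λ ()) (sum-single i λ j j≢i → eq (suc j) λ { refl → j≢i refl })

-- The index is that of a least value. Applied to the weights of an antichain, it compares the whole
-- antichain with one binomial coefficient and so replaces division by the weights.
average : ∀ {n} (w : Fin (suc n) → ℕ) → ∃[ i ] suc n * w i ≤ sum w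
average {zero}  w = zero , ≤-refl
average {suc n} w with i , le ← average (w ∘ suc) with ≤-total (w zero) (w (suc i))
... | inj₁ w₀≤ = zero  , +-monoʳ-≤ (w zero) (≤-trans (*-monoʳ-≤ (suc n) w₀≤) le)
... | inj₂ ≤w₀ = suc i , +-mono-≤ ≤w₀ le

∣p-x∣ : ∀ {n x} {p : Subset n} → x ∈ p → suc ∣ p - x ∣ ≡ ∣ p ∣
∣p-x∣ {p = _ ∷ p}       here        = cong (suc ∘ ∣_∣) (p─⊥≡p p)
∣p-x∣ {p = inside ∷ p}  (there x∈p) = cong suc (∣p-x∣ x∈p)
∣p-x∣ {p = outside ∷ p} (there x∈p) = ∣p-x∣ x∈p

sum-∈ : ∀ {n} (p : Subset n) k → sum (λ x → when (does (x ∈? p)) k) ≡ ∣ p ∣ * k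
sum-∈ []            k = refl
sum-∈ (inside ∷ p)  k = cong (k +_) (sum-∈ p k)
sum-∈ (outside ∷ p) k = sum-∈ p k

-- Counts the elements of `p` outside `q`; the term for `q` stands on the left to avoid truncated
-- subtraction.
sum-─ : ∀ {n} {p q : Subset n} k → q ⊆ p →
        sum (λ x → when (does (x ∈? p)) (if does (x ∈? q) then 0 else k)) + ∣ q ∣ * k ≡ ∣ p ∣ * k
sum-─ {p = []}          {[]}          k q⊆p = refl
sum-─ {p = inside ∷ p}  {inside ∷ q}  k q⊆p = trans
  (trans (sym (+-assoc s k _)) (trans (cong (_+ ∣ q ∣ * k) (+-comm s k)) (+-assoc k s _)))
  (cong (k +_) (sum-─ k (drop-∷-⊆ q⊆p)))
  where s = sum (λ x → when (does (x ∈? p)) (if does (x ∈? q) then 0 else k))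
sum-─ {p = inside ∷ p}  {outside ∷ q} k q⊆p = trans (+-assoc k _ _) (cong (k +_) (sum-─ k (drop-∷-⊆ q⊆p)))
sum-─ {p = outside ∷ p} {inside ∷ q}  k q⊆p with () ← q⊆p here
sum-─ {p = outside ∷ p} {outside ∷ q} k q⊆p = sum-─ k (drop-∷-⊆ q⊆p)

-- The classical bound C(2a, a) ≤ 4^a / √(3a + 1), squared. The factor `3 * a + 1` makes the
-- induction close, with the slack displayed in `middle`; with `2 * a`, which is what the even row
-- asks for, the step would lose the factor (2a + 1)² / (4a(a + 1)) > 1.
[2a]!²[3a+1]≤16^a[a!]⁴ : ∀ a → (a + a) ! * (a + a) ! * (3 * a + 1) ≤ 16 ^ a * (a ! * a ! * (a ! * a !))
[2a]!²[3a+1]≤16^a[a!]⁴ zero    = ≤-refl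
[2a]!²[3a+1]≤16^a[a!]⁴ (suc a) rewrite +-suc a a = begin
  (2+2a * (1+2a * x)) * (2+2a * (1+2a * x)) * (3 * suc a + 1)   ≡⟨ left a x ⟩
  x * x * ((2 * a + 2) * (2 * a + 2) * ((2 * a + 1) * (2 * a + 1)) * (3 * a + 4))
    ≤⟨ *-monoʳ-≤ (x * x) (≤-trans (m≤m+n _ _) (≤-reflexive (sym (middle a)))) ⟩
  x * x * (16 * ((1 + a) * (1 + a) * ((1 + a) * (1 + a))) * (3 * a + 1))   ≡⟨ right a x ⟩
  x * x * (3 * a + 1) * (16 * ((1 + a) * (1 + a) * ((1 + a) * (1 + a))))
    ≤⟨ *-monoˡ-≤ _ ([2a]!²[3a+1]≤16^a[a!]⁴ a) ⟩
  16 ^ a * (y * y * (y * y)) * (16 * ((1 + a) * (1 + a) * ((1 + a) * (1 + a))))   ≡⟨ final a y (16 ^ a) ⟩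
  16 * 16 ^ a * ((1 + a) * y * ((1 + a) * y) * ((1 + a) * y * ((1 + a) * y))) ∎
  where
  open ≤-Reasoning
  x = (a + a) !
  y = a !
  2+2a = suc (suc (a + a))
  1+2a = suc (a + a)
  left : ∀ a x → (suc (suc (a + a)) * (suc (a + a) * x)) * (suc (suc (a + a)) * (suc (a + a) * x)) * (3 * suc a + 1) ≡
         x * x * ((2 * a + 2) * (2 * a + 2) * ((2 * a + 1) * (2 * a + 1)) * (3 * a + 4))
  left = solve-∀
  middle : ∀ a → 16 * ((1 + a) * (1 + a) * ((1 + a) * (1 + a))) * (3 * a + 1) ≡
           (2 * a + 2) * (2 * a + 2) * ((2 * a + 1) * (2 * a + 1)) * (3 * a + 4) + 4 * a * ((1 + a) * (1 + a))
  middle = solve-∀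
  right : ∀ a x → x * x * (16 * ((1 + a) * (1 + a) * ((1 + a) * (1 + a))) * (3 * a + 1)) ≡
          x * x * (3 * a + 1) * (16 * ((1 + a) * (1 + a) * ((1 + a) * (1 + a))))
  right = solve-∀
  final : ∀ a y z → z * (y * y * (y * y)) * (16 * ((1 + a) * (1 + a) * ((1 + a) * (1 + a)))) ≡
          16 * z * ((1 + a) * y * ((1 + a) * y) * ((1 + a) * y * ((1 + a) * y)))
  final = solve-∀

16^a≡4^[a+a] : ∀ a → 16 ^ a ≡ 4 ^ (a + a)
16^a≡4^[a+a] a = trans (^-*-assoc 4 2 a) (cong (4 ^_) (cong (a +_) (+-identityʳ a)))

-- (a + b)! ² (a + b) ≤ 4 ^ (a + b) (a! b!)², that is, C(q, a) ≤ 2 ^ q / √ q, first at the middle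
-- of the row and then outwards.
[q!]²q≤4^q[a!b!]² : ∀ d a → let b = a + d; q = a + b in
                    q ! * q ! * q ≤ 4 ^ q * ((a ! * b !) * (a ! * b !))
[q!]²q≤4^q[a!b!]² zero a rewrite +-identityʳ a = begin
  (a + a) ! * (a + a) ! * (a + a)         ≤⟨ *-monoʳ-≤ ((a + a) ! * (a + a) !) (≤-trans (m≤m+n _ (a + 1)) (≤-reflexive (lemma a))) ⟩
  (a + a) ! * (a + a) ! * (3 * a + 1)     ≤⟨ [2a]!²[3a+1]≤16^a[a!]⁴ a ⟩
  16 ^ a * (a ! * a ! * (a ! * a !))      ≡⟨ cong (_* (a ! * a ! * (a ! * a !))) (16^a≡4^[a+a] a) ⟩
  4 ^ (a + a) * (a ! * a ! * (a ! * a !)) ∎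
  where
  open ≤-Reasoning
  lemma : ∀ a → a + a + (a + 1) ≡ 3 * a + 1
  lemma = solve-∀
-- The middle of an odd row is half the middle of the next row, C(2a + 2, a + 1) = 2 C(2a + 1, a);
-- hence the cancelled factor 4(a + 1)².
[q!]²q≤4^q[a!b!]² (suc zero) a rewrite +-comm a 1 | +-suc a a = *-cancelˡ-≤ (4 * (suc a * suc a)) (begin
  4 * (suc a * suc a) * (q! * q! * suc (a + a))             ≤⟨ *-monoʳ-≤ (4 * (suc a * suc a)) (*-monoʳ-≤ (q! * q!) (≤-trans (m≤m+n _ (a + 3)) (≤-reflexive (1st a)))) ⟩
  4 * (suc a * suc a) * (q! * q! * (3 * suc a + 1))         ≡⟨ 2nd a q! ⟩
  suc (suc (a + a)) * q! * (suc (suc (a + a)) * q!) * (3 * suc a + 1)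
                          ≡⟨ cong (λ k → k ! * k ! * (3 * suc a + 1)) (cong suc (+-suc a a)) ⟨
  (suc a + suc a) ! * (suc a + suc a) ! * (3 * suc a + 1)   ≤⟨ [2a]!²[3a+1]≤16^a[a!]⁴ (suc a) ⟩
  16 ^ suc a * (suc a ! * suc a ! * (suc a ! * suc a !))    ≡⟨ cong (λ k → 16 * k * (suc a ! * suc a ! * (suc a ! * suc a !))) (16^a≡4^[a+a] a) ⟩
  16 * 4 ^ (a + a) * (suc a ! * suc a ! * (suc a ! * suc a !)) ≡⟨ 3rd a (4 ^ (a + a)) (a !) ⟩
  4 * (suc a * suc a) * (4 * 4 ^ (a + a) * ((a ! * suc a !) * (a ! * suc a !))) ∎)
  where
  open ≤-Reasoning
  q! = suc (a + a) !
  1st : ∀ a → suc (a + a) + (a + 3) ≡ 3 * suc a + 1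
  1st = solve-∀
  2nd : ∀ a x → 4 * (suc a * suc a) * (x * x * (3 * suc a + 1)) ≡
        suc (suc (a + a)) * x * (suc (suc (a + a)) * x) * (3 * suc a + 1)
  2nd = solve-∀
  3rd : ∀ a z y → 16 * z * (suc a * y * (suc a * y) * (suc a * y * (suc a * y))) ≡
        4 * (suc a * suc a) * (4 * z * ((y * (suc a * y)) * (y * (suc a * y))))
  3rd = solve-∀
[q!]²q≤4^q[a!b!]² (suc (suc d)) a = begin
  q ! * q ! * q             ≡⟨ cong (λ k → k ! * k ! * k) q≡ ⟩
  q′ ! * q′ ! * q′          ≤⟨ [q!]²q≤4^q[a!b!]² d (suc a) ⟩
  4 ^ q′ * (w′ * w′)        ≤⟨ *-monoʳ-≤ (4 ^ q′) (*-mono-≤ w′≤w w′≤w) ⟩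
  4 ^ q′ * (w * w)          ≡⟨ cong (λ k → 4 ^ k * (w * w)) q≡ ⟨
  4 ^ q * (w * w)           ∎
  where
  open ≤-Reasoning
  q  = a + (a + suc (suc d))
  q′ = suc a + (suc a + d)
  w  = a ! * (a + suc (suc d)) !
  w′ = suc a ! * (suc a + d) !
  q≡ : q ≡ q′
  q≡ = lemma a d
    where lemma : ∀ a d → a + (a + suc (suc d)) ≡ suc a + (suc a + d)
          lemma = solve-∀
  -- Away from the middle of the row the product of the two factorials grows, that is, the binomial
  -- coefficient falls.
  w′≤w : w′ ≤ w
  w′≤w = begin
    suc a * a ! * (suc a + d) !                ≤⟨ *-monoˡ-≤ ((suc a + d) !) (*-monoˡ-≤ (a !) (s≤s (≤-trans (m≤m+n a d) (n≤1+n _)))) ⟩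
    suc (suc (a + d)) * a ! * (suc a + d) !    ≡⟨ shuffle (suc (suc (a + d))) (a !) _ ⟩
    a ! * (suc (suc (a + d)) * (suc a + d) !)  ≡⟨ cong (λ k → a ! * k !) (trans (+-suc a (suc d)) (cong suc (+-suc a d))) ⟨
    w ∎
    where shuffle : ∀ x y z → x * y * z ≡ y * (x * z)
          shuffle = solve-∀

weight-bound : ∀ q a → a ≤ q → let w = a ! * (q ∸ a) ! in q ! * q ! * q ≤ 4 ^ q * (w * w)
weight-bound q a a≤q = case (≤-total a b)
  where
  b = q ∸ a
  w = a ! * b !
  case : a ≤ b ⊎ b ≤ a → q ! * q ! * q ≤ 4 ^ q * (w * w)
  case (inj₁ a≤b) = subst (λ k → k ! * k ! * k ≤ 4 ^ k * (w * w)) (m+[n∸m]≡n a≤q)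
    (subst (λ b → (a + b) ! * (a + b) ! * (a + b) ≤ 4 ^ (a + b) * ((a ! * b !) * (a ! * b !))) (m+[n∸m]≡n a≤b)
      ([q!]²q≤4^q[a!b!]² (b ∸ a) a))
  case (inj₂ b≤a) = subst (λ k → k ! * k ! * k ≤ 4 ^ k * (w * w)) (m∸n+n≡m a≤q)
    (subst (λ w → (b + a) ! * (b + a) ! * (b + a) ≤ 4 ^ (b + a) * (w * w)) (*-comm (b !) (a !))
      (subst (λ a → (b + a) ! * (b + a) ! * (b + a) ≤ 4 ^ (b + a) * ((b ! * a !) * (b ! * a !))) (m+[n∸m]≡n b≤a)
        ([q!]²q≤4^q[a!b!]² (a ∸ b) b)))

-- Counting maximal chains through an antichain

module _ {n m} (F : Fin m → Subset n) (antichain : ∀ {i j} → F i ⊆ F j → i ≡ j) where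

  -- For `∣ T ∣ ≡ q` this is the number of maximal chains of subsets of `T` that pass through `F i`:
  -- the elements of `F i` are added first, in any order, and then the others.
  weight : ℕ → Subset n → Fin m → ℕ
  weight q T i = when (does (F i ⊆? T)) (∣ F i ∣ ! * (q ∸ ∣ F i ∣) !)

  weight-⊆ : ∀ q {T i} → F i ⊆ T → weight q T i ≡ ∣ F i ∣ ! * (q ∸ ∣ F i ∣) !
  weight-⊆ q {T} {i} F⊆T rewrite dec-true (F i ⊆? T) F⊆T = refl

  weight-⊈ : ∀ q {T i} → ¬ F i ⊆ T → weight q T i ≡ 0
  weight-⊈ q {T} {i} F⊈T rewrite dec-false (F i ⊆? T) F⊈T = refl

  weight-≤ : ∀ q {T i k} → (F i ⊆ T → ∣ F i ∣ ! * (q ∸ ∣ F i ∣) ! ≤ k) → weight q T i ≤ k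
  weight-≤ q {T} {i} le with F i ⊆? T
  ... | yes p = le p
  ... | no _  = z≤n

  -- A chain through a proper subset `F i` of `T` reaches `T` by adding some last `x` outside `F i`.
  -- With `a = ∣ F i ∣` there are `suc q ∸ a` choices of `x`, and each leaves `a ! * (q ∸ a) !`
  -- chains of `T - x`.
  weight-step : ∀ q {T} i → ∣ T ∣ ≡ suc q → ¬ T ⊆ F i → F i ⊆ T →
                weight (suc q) T i ≤ sum (λ x → when (does (x ∈? T)) (weight q (T - x) i))
  weight-step q {T} i ∣T∣≡1+q T⊈F F⊆T = begin
    weight (suc q) T i        ≡⟨ weight-⊆ (suc q) F⊆T ⟩
    a ! * (suc q ∸ a) !       ≡⟨ cong (λ k → a ! * k !) (+-∸-assoc 1 a≤q) ⟩
    a ! * (suc e * e !)       ≡⟨ shuffle (a !) (suc e) (e !) ⟩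
    suc e * (a ! * e !)       ≡⟨ +-cancelʳ-≡ (a * k) _ _ (trans (sym (*-distribʳ-+ k (suc e) a)) (trans (cong (_* k) 1+e+a≡∣T∣) (sym (sum-─ k F⊆T)))) ⟩
    sum (λ x → when (does (x ∈? T)) (if does (x ∈? F i) then 0 else k))   ≤⟨ sum-mono outer ⟩
    sum (λ x → when (does (x ∈? T)) (weight q (T - x) i)) ∎
    where
    open ≤-Reasoning
    a = ∣ F i ∣
    e = q ∸ a
    k = a ! * e !
    a≢1+q : a ≢ suc q
    a≢1+q a≡ = T⊈F (λ {x} x∈T → grow (trans a≡ (sym ∣T∣≡1+q)) F⊆T x∈T)
      where
      grow : ∀ {n} {p q : Subset n} → ∣ p ∣ ≡ ∣ q ∣ → p ⊆ q → q ⊆ p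
      grow {p = inside ∷ p}  {inside ∷ q}  eq p⊆q here        = here
      grow {p = outside ∷ p} {inside ∷ q}  eq p⊆q x∈q =
        contradiction (subst (_≤ ∣ q ∣) eq (p⊆q⇒∣p∣≤∣q∣ (drop-∷-⊆ p⊆q))) 1+n≰n
      grow {p = inside ∷ p}  {outside ∷ q} eq p⊆q x∈q with () ← p⊆q here
      grow {p = inside ∷ p}  {inside ∷ q}  eq p⊆q (there x∈q) = there (grow (suc-injective eq) (drop-∷-⊆ p⊆q) x∈q)
      grow {p = outside ∷ p} {outside ∷ q} eq p⊆q (there x∈q) = there (grow eq (drop-∷-⊆ p⊆q) x∈q)
    a≤q : a ≤ q
    a≤q = s≤s⁻¹ (≤∧≢⇒< (subst (a ≤_) ∣T∣≡1+q (p⊆q⇒∣p∣≤∣q∣ F⊆T)) a≢1+q)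
    1+e+a≡∣T∣ : suc e + a ≡ ∣ T ∣
    1+e+a≡∣T∣ = trans (cong suc (m∸n+n≡m a≤q)) (sym ∣T∣≡1+q)
    shuffle : ∀ x y z → x * (y * z) ≡ y * (x * z)
    shuffle = solve-∀
    outer : ∀ x → when (does (x ∈? T)) (if does (x ∈? F i) then 0 else k) ≤
                  when (does (x ∈? T)) (weight q (T - x) i)
    outer x with x ∈? T | x ∈? F i
    ... | no _  | _       = z≤n
    ... | yes _ | yes _   = z≤n
    ... | yes _ | no x∉F  = ≤-reflexive (sym (weight-⊆ q
      (λ y∈F → x∈p∧x≢y⇒x∈p-y (F⊆T y∈F) λ { refl → x∉F y∈F })))

  -- The Lubell–Yamamoto–Meshalkin inequality: maximal chains of subsets of T are counted by
  -- their last proper element T - x.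
  lym : ∀ q T → ∣ T ∣ ≡ q → sum (weight q T) ≤ q !
  lym q T ∣T∣≡q with any? (λ i → (T ⊆? F i) ×-dec (F i ⊆? T))
  -- Here `F i` is `T` itself. By the antichain condition no other member lies below `T`, and all
  -- `q !` chains pass through `F i`.
  lym q T ∣T∣≡q | yes (i , T⊆F , F⊆T) = begin
    sum (weight q T)        ≡⟨ sum-single i (λ j j≢i → weight-⊈ q (λ F⊆T → j≢i (antichain (⊆-trans F⊆T T⊆F)))) ⟩
    weight q T i            ≡⟨ weight-⊆ q F⊆T ⟩
    ∣ F i ∣ ! * (q ∸ ∣ F i ∣) !   ≡⟨ cong (λ a → a ! * (q ∸ a) !) (trans (cong ∣_∣ (⊆-antisym F⊆T T⊆F)) ∣T∣≡q) ⟩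
    q ! * (q ∸ q) !         ≡⟨ cong (λ k → q ! * k !) (n∸n≡0 q) ⟩
    q ! * 1                 ≡⟨ *-identityʳ (q !) ⟩
    q !                     ∎
    where open ≤-Reasoning
  lym zero T ∣T∣≡0 | no ∄ = ≤-trans (≤-reflexive (sum-zero λ i → weight-⊈ 0 λ F⊆T →
    ∄ (i , (λ x∈T → contradiction (trans (∣p-x∣ x∈T) ∣T∣≡0) λ ()) , F⊆T))) z≤n
  lym (suc q) T ∣T∣≡1+q | no ∄ = begin
    sum (weight (suc q) T)
      ≤⟨ sum-mono (λ i → weight-≤ (suc q) λ F⊆T → ≤-trans (≤-reflexive (sym (weight-⊆ (suc q) F⊆T)))
           (weight-step q i ∣T∣≡1+q (λ T⊆F → ∄ (i , T⊆F , F⊆T)) F⊆T)) ⟩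
    sum (λ i → sum (λ x → when (does (x ∈? T)) (weight q (T - x) i)))
      ≡⟨ ∑-comm (λ i x → when (does (x ∈? T)) (weight q (T - x) i)) ⟩
    sum (λ x → sum (λ i → when (does (x ∈? T)) (weight q (T - x) i)))
      ≤⟨ sum-mono level ⟩
    sum (λ x → when (does (x ∈? T)) (q !))   ≡⟨ sum-∈ T (q !) ⟩
    ∣ T ∣ * q !                              ≡⟨ cong (_* q !) ∣T∣≡1+q ⟩
    suc q * q !                              ∎
    where
    open ≤-Reasoning
    level : ∀ x → sum (λ i → when (does (x ∈? T)) (weight q (T - x) i)) ≤ when (does (x ∈? T)) (q !)
    level x with x ∈? T
    ... | yes x∈T = lym q (T - x) (suc-injective (trans (∣p-x∣ x∈T) ∣T∣≡1+q))
    ... | no _    = ≤-reflexive (sum-zero {f = λ (i : Fin m) → 0} λ _ → refl)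

-- If `w` is a least weight, then `m * w ≤ q !`, so that `m` is at most the binomial coefficient
-- belonging to `w`. Squaring, inserting the estimate for that coefficient and cancelling `w * w`
-- leaves `m ≤ 2 ^ q / √ q` in squared form.
sperner : ∀ {n m} (F : Fin m → Subset n) → (∀ {i j} → F i ⊆ F j → i ≡ j) →
          ∀ T → (∀ i → F i ⊆ T) → m * m * ∣ T ∣ ≤ 4 ^ ∣ T ∣
sperner {m = zero}  F antichain T F⊆T = z≤n
sperner {m = suc m} F antichain T F⊆T
  with i , le ← average (weight F antichain ∣ T ∣ T) = *-cancelʳ-≤ _ _ (w * w) (begin
    suc m * suc m * q * (w * w)       ≡⟨ shuffle (suc m) q w ⟩
    suc m * w * (suc m * w) * q       ≤⟨ *-monoˡ-≤ q (*-mono-≤ mw≤q! mw≤q!) ⟩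
    q ! * q ! * q                     ≤⟨ weight-bound q ∣ F i ∣ (p⊆q⇒∣p∣≤∣q∣ (F⊆T i)) ⟩
    4 ^ q * (w * w)                   ∎)
  where
  open ≤-Reasoning
  q = ∣ T ∣
  w = ∣ F i ∣ ! * (q ∸ ∣ F i ∣) !
  mw≤q! : suc m * w ≤ q !
  mw≤q! = ≤-trans (subst (λ k → suc m * k ≤ _) (weight-⊆ F antichain q (F⊆T i)) le)
            (lym F antichain q T refl)
  shuffle : ∀ x q w → x * x * q * (w * w) ≡ x * w * (x * w) * q
  shuffle = solve-∀
  instance
    w≢0 : NonZero (w * w)
    w≢0 = m*n≢0 w w {{w′}} {{w′}}
      where w′ = m*n≢0 (∣ F i ∣ !) ((q ∸ ∣ F i ∣) !) {{∣ F i ∣ !≢0}} {{(q ∸ ∣ F i ∣) !≢0}}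

4^p≡2^p*2^p : ∀ p → 4 ^ p ≡ 2 ^ p * 2 ^ p
4^p≡2^p*2^p p = trans (^-*-assoc 2 2 p)
  (trans (cong (2 ^_) (cong (p +_) (+-identityʳ p))) (^-distribˡ-+-* 2 p p))

-- A ceiling `M < m` would give M² p < m² p ≤ 4^p ≤ M² p.
p+m≤kernelBound : ∀ {p m} → 0 < p → m * m * p ≤ 4 ^ p → p + m ≤ kernelBound p
p+m≤kernelBound {p@(suc _)} {m} _ le with least-ceil (2 ^ p) p
... | M , ceil , _ = +-monoʳ-≤ p (≮⇒≥ λ M<m → <⇒≱ (*-monoˡ-< p (*-mono-< M<m M<m)) (begin
  m * m * p        ≤⟨ le ⟩
  4 ^ p            ≡⟨ 4^p≡2^p*2^p p ⟩
  2 ^ p * 2 ^ p    ≤⟨ ceil ⟩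
  M * M * p        ∎))
  where open ≤-Reasoning

kernelBound≤ : ∀ p → kernelBound p ≤ p + 2 ^ p
kernelBound≤ zero = z≤n
kernelBound≤ p@(suc _) with least-ceil (2 ^ p) p
... | M , _ , min = +-monoʳ-≤ p (min (2 ^ p) (m≤m*n (2 ^ p * 2 ^ p) p))

-- Retracts in the game of cops and robber

module _ (G : Graph) (k : ℕ) (k≥order : Graph.order G ≤ k) (v : Graph.Vertex G) where

  open Graph G using (order; Vertex)
  open Game G k

  copwin-many : CopWin
  copwin-many = place , λ r → caught (inject≤ r k≥order , placed r)
    where
    place : Cops
    place i with toℕ i <? order
    ... | yes i< = fromℕ< i<
    ... | no  _  = v
    placed : ∀ r → place (inject≤ r k≥order) ≡ r
    placed r with toℕ (inject≤ r k≥order) <? order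
    ... | yes i< = toℕ-injective (trans (toℕ-fromℕ< i<) (toℕ-inject≤ r k≥order))
    ... | no  i≮ = contradiction (subst (_< order) (sym (toℕ-inject≤ r k≥order)) (toℕ<n r)) i≮

-- Once there are as many cops as vertices, a cop on every vertex wins at once, so further cops do
-- not change the answer.
copwin-⊓ : ∀ G k → Graph.Vertex G → Game.CopWin G k ⇔ Game.CopWin G (k ⊓ Graph.order G)
copwin-⊓ G k v with ≤-total k (Graph.order G)
... | inj₁ k≤n rewrite m≤n⇒m⊓n≡m k≤n = mk⇔ (λ w → w) (λ w → w)
... | inj₂ n≤k rewrite m≥n⇒m⊓n≡n n≤k =
  mk⇔ (λ _ → copwin-many G (Graph.order G) ≤-refl v) (λ _ → copwin-many G k n≤k v)

-- Nobody can catch a robber who stays put, so a winning game tree would have an infinite branch.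
no-cops : ∀ G → Graph.Vertex G → ¬ Game.CopWin G 0
no-cops G v (c , win) = cop (win v)
  where
  open Game G 0
  mutual
    cop : ∀ {c r} → ¬ CopsToMove c r
    cop (move c′ _ w) = robber w
    robber : ∀ {c r} → ¬ RobberToMove c r
    robber (move w) = cop (w _ refl)

-- `H` is embedded by `σ` as an induced subgraph, and `ρ` sends each vertex to one of `H` with at
-- least the same neighbours. This allows any number of dominated vertices to be removed in one
-- step.
module Retraction (G H : Graph) (σ : Graph.Vertex H → Graph.Vertex G) (ρ : Graph.Vertex G → Graph.Vertex H)
  (σ-adj : ∀ {a b} → Graph.Adj H a b → Graph.Adj G (σ a) (σ b))
  (σ-adj⁻ : ∀ {a b} → Graph.Adj G (σ a) (σ b) → Graph.Adj H a b)
  (ρσ : ∀ a → ρ (σ a) ≡ a)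
  (dominates : ∀ {u w} → Graph.Adj G u w → Graph.Adj G (σ (ρ u)) w) where

  open Graph
  open Game

  -- Domination is used at one end of the edge and, after turning the edge around, at the other.
  ρ-adj : ∀ {u v} → Adj G u v → Adj H (ρ u) (ρ v)
  ρ-adj u~v = σ-adj⁻ (symm G (dominates (symm G (dominates u~v))))

  ρ-move : ∀ {u v} → ReflClosure (Adj G) u v → ReflClosure (Adj H) (ρ u) (ρ v)
  ρ-move refl        = refl
  ρ-move (along u~v) = along (ρ-adj u~v)

  σ-move : ∀ {a b} → ReflClosure (Adj H) a b → ReflClosure (Adj G) (σ a) (σ b)
  σ-move refl        = refl
  σ-move (along a~b) = along (σ-adj a~b)

  retract-connected : Connected G → Connected H
  retract-connected conn a b = subst₂ (Star (Adj H)) (ρσ a) (ρσ b) (gmap ρ ρ-adj (conn (σ a) (σ b)))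

  module _ {k : ℕ} where

    mutual
      -- The robber stays inside the copy of `H`, which `ρ` fixes, so the images of the cops under
      -- `ρ` catch him whenever the cops do. This direction works for every number of cops.
      project-cops : ∀ {c a} → CopsToMove G k c (σ a) → CopsToMove H k (ρ ∘ c) a
      project-cops (caught (i , eq))  = caught (i , trans (cong ρ eq) (ρσ _))
      project-cops (move c′ moves w)  = move (ρ ∘ c′) (ρ-move ∘ moves) (project-robber w)

      project-robber : ∀ {c a} → RobberToMove G k c (σ a) → RobberToMove H k (ρ ∘ c) a
      project-robber (caught (i , eq)) = caught (i , trans (cong ρ eq) (ρσ _))
      project-robber (move w)          = move λ a′ a→a′ → project-cops (w (σ a′) (σ-move a→a′))

  module _ (conn : Connected G) {k : ℕ} where

    private
      k₂ : ℕ
      k₂ = suc (suc k)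

    set : Cops G k₂ → Fin k₂ → Vertex G → Cops G k₂
    set c i v = updateAt c i (λ _ → v)

    set-at : ∀ i c {v} → set c i v i ≡ v
    set-at i c = updateAt-updates i c

    set-off : ∀ i j c {v} → i ≢ j → set c j v i ≡ c i
    set-off i j c i≢j = updateAt-minimal i j c i≢j

    move-one : ∀ (c : Cops G k₂) i v → ReflClosure (Adj G) (c i) v →
               ∀ j → ReflClosure (Adj G) (c j) (set c i v j)
    move-one c i v m j with j ≟ᶠ i
    ... | yes refl = subst (ReflClosure (Adj G) (c j)) (sym (set-at j c)) m
    ... | no  j≢i  = subst (ReflClosure (Adj G) (c j)) (sym (set-off j i c j≢i)) refl

    -- The robber may not leave r while cop i dominates it; meanwhile another cop j walks up to r.
    chase : ∀ {r} i j → j ≢ i → ∀ c → (∀ {w} → Adj G r w → Adj G (c i) w) →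
            ∀ {v} → c j ≡ v → Star (Adj G) v r → CopsToMove G k₂ c r
    chase i j j≢i c dom eq ε = caught (j , eq)
    chase {r} i j j≢i c dom {v} eq (_◅_ {j = v′} v~v′ walk) =
      move c′ (move-one c j v′ (along (subst (λ x → Adj G x v′) (sym eq) v~v′))) (move λ where
        _ refl → chase i j j≢i c′ dom′ (set-at j c) walk
        w (along r~w) → move (set c′ i w) (move-one c′ i w (along (dom′ r~w)))
                      (caught (i , set-at i c′)))
      where
      c′ = set c j v′
      dom′ : ∀ {w} → Adj G r w → Adj G (c′ i) w
      dom′ r~w = subst (λ x → Adj G x _) (sym (set-off i j c (≢-sym j≢i))) (dom r~w)

    other : ∀ (i : Fin k₂) → ∃[ j ] j ≢ i
    other zero    = suc zero , λ ()
    other (suc _) = zero , λ ()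

    -- A cop on `ρ r` in `H` stands on `σ (ρ r)` in `G` and so dominates `r`; connectedness provides
    -- the walk of a second cop.
    shadow-caught : ∀ {c r} → Caught H k₂ c (ρ r) → CopsToMove G k₂ (σ ∘ c) r
    shadow-caught {c} {r} (i , eq) with j , j≢i ← other i =
      chase i j j≢i (σ ∘ c) (λ r~w → subst (λ a → Adj G (σ a) _) (sym eq) (dominates r~w)) refl (conn _ r)

    -- A robber who leaves `r` lands on a neighbour of `r`, which is also a neighbour of the cop on
    -- `σ (ρ r)`.
    capture : ∀ {c r w} → Caught H k₂ c (ρ r) → Adj G r w → CopsToMove G k₂ (σ ∘ c) w
    capture {c} {r} {w} (i , eq) r~w = move (set (σ ∘ c) i w)
      (move-one (σ ∘ c) i w (along (subst (λ a → Adj G (σ a) w) (sym eq) (dominates r~w))))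
      (caught (i , set-at i (σ ∘ c)))

    mutual
      -- The cops follow their strategy on `H` against the shadow `ρ r`, whose steps are legal
      -- because `ρ` preserves moves. Once the shadow is caught, the robber is pinned.
      lift-cops : ∀ {c r} → CopsToMove H k₂ c (ρ r) → CopsToMove G k₂ (σ ∘ c) r
      lift-cops (caught w)        = shadow-caught w
      lift-cops (move c′ moves w) = move (σ ∘ c′) (σ-move ∘ moves) (lift-robber w)

      lift-robber : ∀ {c r} → RobberToMove H k₂ c (ρ r) → RobberToMove G k₂ (σ ∘ c) r
      lift-robber {r = r} (caught w) = move λ where
        _ refl    → shadow-caught w
        w′ (along r~w′) → capture w r~w′
      lift-robber (move w)          = move λ r′ r→r′ → lift-cops (w (ρ r′) (ρ-move r→r′))

    retract-copwin : CopWin G k₂ ⇔ CopWin H k₂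
    retract-copwin = mk⇔
      (λ (c , win) → ρ ∘ c , λ a → project-cops (win (σ a)))
      (λ (c , win) → σ ∘ c , λ r → lift-cops (win (ρ r)))

-- The graph of kept vertices

lookup-injective : ∀ {A : Set} {xs : List A} → Unique xs → ∀ {i j} → lookup xs i ≡ lookup xs j → i ≡ j
lookup-injective (x∉ ∷ u) {zero}  {zero}  eq = refl
lookup-injective (x∉ ∷ u) {zero}  {suc j} eq = contradiction eq (All.lookup x∉ (∈-lookup j))
lookup-injective (x∉ ∷ u) {suc i} {zero}  eq = contradiction (sym eq) (All.lookup x∉ (∈-lookup i))
lookup-injective (x∉ ∷ u) {suc i} {suc j} eq = cong suc (lookup-injective u eq)

-- A union bound, meant for `P` the kept vertices, `p` a vertex cover and `Q` the kept vertices
-- outside it. The enumeration `f` is arbitrary because the induction shifts it.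
length-filter-≤ : ∀ {A : Set} {P Q : A → Set} (P? : U.Decidable P) (Q? : U.Decidable Q) {n} (f : Fin n → A)
  (p : Subset n) → (∀ i → P (f i) → i ∈ p ⊎ Q (f i)) →
  length (filter P? (tabulate f)) ≤ ∣ p ∣ + length (filter Q? (tabulate f))
length-filter-≤ P? Q? {zero}  f []      cover = z≤n
length-filter-≤ {P = P} {Q} P? Q? {suc n} f (s ∷ p) cover = go s (P? (f zero)) (Q? (f zero)) cover
  where
  rest : ∀ {s} → (∀ i → P (f i) → i ∈ s ∷ p ⊎ Q (f i)) →
         length (filter P? (tabulate (f ∘ suc))) ≤ ∣ p ∣ + length (filter Q? (tabulate (f ∘ suc)))
  rest cover = length-filter-≤ P? Q? (f ∘ suc) p λ i pi → [ (λ { (Vec.there x) → inj₁ x }) , inj₂ ]′ (cover (suc i) pi)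
  grow : ∀ s → ∣ p ∣ ≤ ∣ s ∷ p ∣
  grow inside  = n≤1+n _
  grow outside = ≤-refl
  go : ∀ s → Dec (P (f zero)) → Dec (Q (f zero)) → (∀ i → P (f i) → i ∈ s ∷ p ⊎ Q (f i)) →
       length (filter P? (tabulate f)) ≤ ∣ s ∷ p ∣ + length (filter Q? (tabulate f))
  go s (no ¬p) (no ¬q) c rewrite filter-reject P? {f zero} {tabulate (f ∘ suc)} ¬p | filter-reject Q? {f zero} {tabulate (f ∘ suc)} ¬q =
    ≤-trans (rest c) (+-monoˡ-≤ _ (grow s))
  go s (no ¬p) (yes q) c rewrite filter-reject P? {f zero} {tabulate (f ∘ suc)} ¬p | filter-accept Q? {f zero} {tabulate (f ∘ suc)} q =
    ≤-trans (rest c) (+-mono-≤ (grow s) (n≤1+n _))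
  go s (yes p₀) (yes q) c rewrite filter-accept P? {f zero} {tabulate (f ∘ suc)} p₀ | filter-accept Q? {f zero} {tabulate (f ∘ suc)} q =
    ≤-trans (s≤s (≤-trans (rest c) (+-monoˡ-≤ _ (grow s)))) (≤-reflexive (sym (+-suc _ _)))
  go inside (yes p₀) (no ¬q) c rewrite filter-accept P? {f zero} {tabulate (f ∘ suc)} p₀ | filter-reject Q? {f zero} {tabulate (f ∘ suc)} ¬q =
    s≤s (rest c)
  go outside (yes p₀) (no ¬q) c with c zero p₀
  ... | inj₂ q = contradiction q ¬q

-- Only vertices with inclusion-maximal neighbourhoods are kept, and of several vertices with the
-- same neighbourhood the last one.
module Domination (G : Graph) where
  open Graph G

  Dominates : Vertex → Vertex → Set
  Dominates v u = ∀ w → Adj u w → Adj v w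

  dominates? : ∀ v u → Dec (Dominates v u)
  dominates? v u = all? λ w → Adj? u w →-dec Adj? v w

  _⊏_ : Vertex → Vertex → Set
  u ⊏ v = Dominates v u × (¬ Dominates u v ⊎ u <ᶠ v)

  _⊏?_ : ∀ u v → Dec (u ⊏ v)
  u ⊏? v = dominates? v u ×-dec (¬? (dominates? u v) ⊎-dec (u <ᶠ? v))

  ⊏-irrefl : ∀ {u} → ¬ u ⊏ u
  ⊏-irrefl (d , inj₁ ¬d)  = ¬d d
  ⊏-irrefl (d , inj₂ u<u) = <ᶠ-irrefl refl u<u

  ⊏-trans : ∀ {u v w} → u ⊏ v → v ⊏ w → u ⊏ w
  ⊏-trans {u} {v} {w} (vu , p) (wv , q) = (λ x → wv x ∘ vu x) , last p q
    where
    last : ¬ Dominates u v ⊎ u <ᶠ v → ¬ Dominates v w ⊎ v <ᶠ w → ¬ Dominates u w ⊎ u <ᶠ w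
    last (inj₁ ¬uv) _          = inj₁ λ uw → ¬uv λ x → uw x ∘ wv x
    last (inj₂ u<v) (inj₁ ¬vw) = inj₁ λ uw → ¬vw λ x → vu x ∘ uw x
    last (inj₂ u<v) (inj₂ v<w) = inj₂ (<ᶠ-trans u<v v<w)

  ⊏-isStrictPartialOrder : IsStrictPartialOrder _≡_ _⊏_
  ⊏-isStrictPartialOrder = record
    { isEquivalence = isEquivalence
    ; irrefl        = λ { refl → ⊏-irrefl }
    ; trans         = ⊏-trans
    ; <-resp-≈      = (λ { refl p → p }) , (λ { refl p → p })
    }

  Kept : Vertex → Set
  Kept u = ¬ ∃ (u ⊏_)

  kept? : U.Decidable Kept
  kept? u = ¬? (any? (u ⊏?_))

  -- Passing to larger vertices of the strict partial order ends, the graph being finite, at a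
  -- maximal one; domination composes along the way.
  kept-dominator : ∀ u → ∃[ v ] Kept v × Dominates v u
  kept-dominator u = go u (spo-noetherian ⊏-isStrictPartialOrder u)
    where
    go : ∀ u → Acc (flip _⊏_) u → ∃[ v ] Kept v × Dominates v u
    go u (acc rs) with any? (u ⊏?_)
    ... | no  kept = u , kept , λ _ a → a
    ... | yes (v , u⊏v) with w , kept , d ← go v (rs u⊏v) = w , kept , λ x → d x ∘ proj₁ u⊏v x

  -- Between two different vertices domination always makes one of them smaller: if the
  -- neighbourhoods are equal, the one of smaller index, and otherwise the dominated one.
  kept-antichain : ∀ {u v} → Kept u → Kept v → Dominates v u → u ≡ v
  kept-antichain {u} {v} ku kv d with <ᶠ-cmp u v
  ... | tri≈ _ eq _  = eq
  ... | tri< u<v _ _ = contradiction (v , d , inj₂ u<v) ku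
  ... | tri> _ _ v<u with dominates? u v
  ...   | yes d′ = contradiction (u , d′ , inj₂ v<u) kv
  ...   | no ¬d′ = contradiction (v , d , inj₁ ¬d′) ku

  keptList : List Vertex
  keptList = filter kept? (allFin order)

  keptList-unique : Unique keptList
  keptList-unique = filter⁺ kept? (allFin⁺ order)

  σ : Fin (length keptList) → Vertex
  σ = lookup keptList

  σ-kept : ∀ a → Kept (σ a)
  σ-kept a = proj₂ (∈-filter⁻ kept? {xs = allFin order} (∈-lookup a))

  keptGraph : Graph
  keptGraph = record
    { order  = length keptList
    ; Adj    = λ a b → Adj (σ a) (σ b)
    ; Adj?   = λ a b → Adj? (σ a) (σ b)
    ; irrefl = λ eq → irrefl (cong σ eq)
    ; symm   = symm
    }

  dominator∈ : ∀ u → proj₁ (kept-dominator u) ∈ˡ keptList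
  dominator∈ u = ∈-filter⁺ kept? (∈-allFin _) (proj₁ (proj₂ (kept-dominator u)))

  ρ : Vertex → Fin (length keptList)
  ρ u = index (dominator∈ u)

  σρ-dominates : ∀ u → Dominates (σ (ρ u)) u
  σρ-dominates u = subst (λ v → Dominates v u) (lookup-index (dominator∈ u)) (proj₂ (proj₂ (kept-dominator u)))

  -- The vertex chosen for `σ a` is kept and dominates the kept vertex `σ a`, so it is `σ a` itself.
  ρσ : ∀ a → ρ (σ a) ≡ a
  ρσ a = lookup-injective keptList-unique
    (sym (kept-antichain (σ-kept a) (σ-kept (ρ (σ a))) (σρ-dominates (σ a))))

  open Retraction G keptGraph σ ρ (λ e → e) (λ e → e) ρσ (σρ-dominates _ _) public
    using (retract-connected; ρ-adj; retract-copwin)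

  keptGraph-hasEdge : HasEdge → Graph.HasEdge keptGraph
  keptGraph-hasEdge (u , v , u~v) = ρ u , ρ v , ρ-adj u~v

  neighbours : Vertex → Subset order
  neighbours u = subset (Adj? u)

  covered : ∀ {S} → VertexCover S → ∀ {u v} → u ∉ S → Adj u v → v ∈ S
  covered {S} cover {u} {v} u∉S u~v with v ∈? S
  ... | yes v∈S = v∈S
  ... | no  v∉S = contradiction u~v (cover u v (x∉p⇒x∈∁p u∉S) (x∉p⇒x∈∁p v∉S))

  vertexCover-nonempty : HasEdge → ∀ {S} → VertexCover S → 0 < ∣ S ∣
  vertexCover-nonempty (u , v , u~v) {S} cover with u ∈? S
  ... | yes u∈S = subst (0 <_) (∣p-x∣ u∈S) z<s
  ... | no  u∉S = subst (0 <_) (∣p-x∣ (covered cover u∉S u~v)) z<s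

  vcn-positive : HasEdge → 0 < vcn
  vcn-positive edge with least-vcn
  ... | _ , (_ , cover , refl) , _ = vertexCover-nonempty edge cover

  -- Outside a vertex cover S, the kept vertices have pairwise incomparable neighbourhoods inside S.
  keptGraph-order : HasEdge → Graph.order keptGraph ≤ kernelBound vcn
  keptGraph-order edge with least-vcn
  ... | _ , (S , cover , refl) , _ = ≤-trans (length-filter-≤ kept? outside? (λ u → u) S split)
    (p+m≤kernelBound (vertexCover-nonempty edge cover) (sperner F antichain S F⊆S))
    where
    Outside : Vertex → Set
    Outside u = Kept u × u ∉ S
    outside? : U.Decidable Outside
    outside? u = kept? u ×-dec ¬? (u ∈? S)
    split : ∀ u → Kept u → u ∈ S ⊎ Outside u
    split u ku with u ∈? S
    ... | yes u∈S = inj₁ u∈S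
    ... | no  u∉S = inj₂ (ku , u∉S)
    L : List Vertex
    L = filter outside? (allFin order)
    L-outside : ∀ i → Outside (lookup L i)
    L-outside i = proj₂ (∈-filter⁻ outside? {xs = allFin order} (∈-lookup i))
    F : Fin (length L) → Subset order
    F i = neighbours (lookup L i)
    F⊆S : ∀ i → F i ⊆ S
    F⊆S i w∈F = covered cover (proj₂ (L-outside i)) (∈-subset⁻ (Adj? _) w∈F)
    antichain : ∀ {i j} → F i ⊆ F j → i ≡ j
    antichain {i} {j} F⊆F = lookup-injective (filter⁺ outside? (allFin⁺ order))
      (kept-antichain (proj₁ (L-outside i)) (proj₁ (L-outside j))
        λ w a → ∈-subset⁻ (Adj? _) (F⊆F (∈-subset⁺ (Adj? _) a)))

-- Words in memory and numbers as truth values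

cells-++ʳ : ∀ xs ys i → cells (xs ++ ys) (length xs + i) ≡ cells ys i
cells-++ʳ []       ys i = refl
cells-++ʳ (x ∷ xs) ys i = cells-++ʳ xs ys i

cells-++ˡ : ∀ xs ys {i} → i < length xs → cells (xs ++ ys) i ≡ cells xs i
cells-++ˡ (x ∷ xs) ys {zero}  _       = refl
cells-++ˡ (x ∷ xs) ys {suc i} (s<s i<) = cells-++ˡ xs ys i<

cells-beyond : ∀ xs {i} → length xs ≤ i → cells xs i ≡ 0
cells-beyond []       _        = refl
cells-beyond (x ∷ xs) (s≤s le) = cells-beyond xs le

cells-tabulate : ∀ {n} (f : Fin n → ℕ) i → cells (tabulate f) (toℕ i) ≡ f i
cells-tabulate f zero    = refl
cells-tabulate f (suc i) = cells-tabulate (f ∘ suc) i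

length-concatMap : ∀ {A : Set} {n m} (f : Fin n → A) (g : A → List ℕ) → (∀ a → length (g a) ≡ m) →
                   length (concatMap g (tabulate f)) ≡ n * m
length-concatMap {n = zero}  f g len = refl
length-concatMap {n = suc n} f g len =
  trans (length-++ (g (f zero))) (cong₂ _+_ (len (f zero)) (length-concatMap (f ∘ suc) g len))

cells-concatMap : ∀ {A : Set} {n m} (f : Fin n → A) (g : A → List ℕ) → (∀ a → length (g a) ≡ m) →
                  ∀ i {j} → j < m → cells (concatMap g (tabulate f)) (toℕ i * m + j) ≡ cells (g (f i)) j
cells-concatMap {n = suc n} f g len zero    j<m = cells-++ˡ (g (f zero)) _ (subst (_ <_) (sym (len (f zero))) j<m)
cells-concatMap {n = suc n} {m} f g len (suc i) {j} j<m = trans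
  (cong (cells (concatMap g (tabulate f))) (trans (+-assoc m (toℕ i * m) j) (cong (_+ (toℕ i * m + j)) (sym (len (f zero))))))
  (trans (cells-++ʳ (g (f zero)) _ (toℕ i * m + j)) (cells-concatMap (f ∘ suc) g len i j<m))

-- Every positive number counts as true, so that addition is disjunction and summation is
-- existential quantification; `1 ∸ n` is negation and always yields 0 or 1.
record _decides_ (n : ℕ) (P : Set) : Set where
  field
    sound    : 0 < n → P
    complete : P → 0 < n

open _decides_ public

decided : ∀ {n P} → n decides P → Dec P
decided {n} d = map′ (sound d) (complete d) (0 <? n)

decides-pos : ∀ {n} → n decides (0 < n)
decides-pos = record { sound = λ p → p ; complete = λ p → p }

decides-⇔ : ∀ {n P Q} → (P → Q) → (Q → P) → n decides P → n decides Q
decides-⇔ f g d = record { sound = f ∘ sound d ; complete = complete d ∘ g }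

decides-if : ∀ {P : Set} (P? : Dec P) → (if does P? then 1 else 0) decides P
decides-if (yes p) = record { sound = λ _ → p ; complete = λ _ → z<s }
decides-if (no ¬p) = record { sound = λ () ; complete = λ p → contradiction p ¬p }

decided-value : ∀ {n P} → n decides P → n ≤ 1 → (P? : Dec P) → n ≡ (if does P? then 1 else 0)
decided-value d n≤1 (yes p) = ≤-antisym n≤1 (complete d p)
decided-value {zero}  d n≤1 (no ¬p) = refl
decided-value {suc n} d n≤1 (no ¬p) = contradiction (sound d z<s) ¬p

1∸n≤1 : ∀ n → 1 ∸ n ≤ 1
1∸n≤1 n = m∸n≤m 1 n

decides-¬ : ∀ {n P} → n decides P → (1 ∸ n) decides (¬ P)
decides-¬ {zero}  d = record { sound = λ _ p → contradiction (complete d p) λ () ; complete = λ _ → z<s }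
decides-¬ {suc n} d = record
  { sound    = λ p → contradiction (subst (0 <_) (0∸n≡0 n) p) λ ()
  ; complete = λ ¬p → contradiction (sound d z<s) ¬p }

decides-⊎ : ∀ {m n P Q} → m decides P → n decides Q → (m + n) decides (P ⊎ Q)
decides-⊎ {zero}  d e = record { sound = inj₂ ∘ sound e ; complete = [ (λ p → contradiction (complete d p) λ ()) , complete e ]′ }
decides-⊎ {suc m} d e = record { sound = λ _ → inj₁ (sound d z<s) ; complete = λ _ → z<s }

-- Conjunction by De Morgan, as there is no multiplication.
decides-× : ∀ {m n P Q} → m decides P → n decides Q → (1 ∸ ((1 ∸ m) + (1 ∸ n))) decides (P × Q)
decides-× {suc m} {suc n} d e = record
  { sound    = λ _ → sound d z<s , sound e z<s
  ; complete = λ _ → subst (λ k → 0 < 1 ∸ k) (sym (cong₂ _+_ (0∸n≡0 m) (0∸n≡0 n))) z<s }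
decides-× {zero} {n} d e = record
  { sound    = λ p → contradiction (subst (0 <_) (0∸n≡0 (1 ∸ n)) p) λ ()
  ; complete = λ (p , _) → contradiction (complete d p) λ () }
decides-× {suc m} {zero} d e = record
  { sound    = λ p → contradiction (subst (λ k → 0 < 1 ∸ (k + 1)) (0∸n≡0 m) p) λ ()
  ; complete = λ (_ , q) → contradiction (complete e q) λ () }

-- The inner sum of truncated differences is the distance of the two indices.
decides-≡ : ∀ {n} (i j : Fin n) → (1 ∸ ((toℕ i ∸ toℕ j) + (toℕ j ∸ toℕ i))) decides (i ≡ j)
decides-≡ i j = record
  { sound    = λ p → toℕ-injective (≤-antisym
      (m∸n≡0⇒m≤n (m+n≡0⇒m≡0 (toℕ i ∸ toℕ j) (zero-sum _ p)))
      (m∸n≡0⇒m≤n (m+n≡0⇒n≡0 (toℕ i ∸ toℕ j) (zero-sum _ p))))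
  ; complete = λ { refl → subst (λ k → 0 < 1 ∸ (k + k)) (sym (n∸n≡0 (toℕ i))) z<s } }
  where
  zero-sum : ∀ k → 0 < 1 ∸ k → k ≡ 0
  zero-sum zero    _ = refl
  zero-sum (suc k) p = contradiction (subst (0 <_) (0∸n≡0 k) p) λ ()

decides-< : ∀ {m n} → (n ∸ m) decides (m < n)
decides-< {m} {n} = record { sound = λ p → m∸n≢0⇒n<m (≢-sym (<⇒≢ p)) ; complete = m<n⇒0<n∸m }

sumTo-∃ : ∀ n {f} → 0 < sumTo n f → ∃[ i ] i < n × 0 < f i
sumTo-∃ (suc n) {f} p with f n in eq
... | suc _ = n , ≤-refl , subst (0 <_) (sym eq) z<s
... | zero with i , i<n , q ← sumTo-∃ n p = i , m<n⇒m<1+n i<n , q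

sumTo-≥ : ∀ {n} f {i} → i < n → f i ≤ sumTo n f
sumTo-≥ {suc n} f {i} i<1+n with m≤n⇒m<n∨m≡n (s≤s⁻¹ i<1+n)
... | inj₁ i<n  = ≤-trans (sumTo-≥ f i<n) (m≤n+m _ (f n))
... | inj₂ refl = m≤m+n (f i) _

sumTo-const : ∀ n c → sumTo n (λ _ → c) ≡ n * c
sumTo-const zero    c = refl
sumTo-const (suc n) c = cong (c +_) (sumTo-const n c)

decides-∃ : ∀ {n f} {P : Fin n → Set} → (∀ i → f (toℕ i) decides P i) → sumTo n f decides (∃ P)
decides-∃ {n} {f} {P} d = record
  { sound    = λ p → let i , i<n , q = sumTo-∃ n p in
                 fromℕ< i<n , sound (d _) (subst (λ i → 0 < f i) (sym (toℕ-fromℕ< i<n)) q)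
  ; complete = λ (i , p) → <-≤-trans (complete (d i) p) (sumTo-≥ f (toℕ<n i)) }

-- No instance fails; the double negation can be removed because each instance is decided.
decides-∀ : ∀ {n} {f : ℕ → ℕ} {P : Fin n → Set} → (∀ i → f (toℕ i) decides P i) →
            (1 ∸ sumTo n (λ i → 1 ∸ f i)) decides (∀ i → P i)
decides-∀ {f = f} {P} d = decides-⇔
  (λ ∄ i → stable i λ ¬p → ∄ (i , ¬p)) (λ p (i , ¬p) → ¬p (p i))
  (decides-¬ (decides-∃ {f = λ i → 1 ∸ f i} λ i → decides-¬ (d i)))
  where
  stable : ∀ i → ¬ ¬ P i → P i
  stable i ¬¬p with decided (d i)
  ... | yes p = p
  ... | no ¬p = contradiction ¬p ¬¬p

-- The game with one cop

infixl 7 _and_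

not : ∀ {n} → Expr n → Expr n
not e = lit 1 ⊖ e

_and_ : ∀ {n} → Expr n → Expr n → Expr n
e and f = not (not e ⊕ not f)

every : ∀ {n} → Expr (suc n) → Expr n
every e = not (∑ (not e))

minimum : ∀ {n} → Expr n → Expr n → Expr n
minimum e f = e ⊖ (e ⊖ f)

equals : ∀ {n} → Fin n → Fin n → Expr n
equals i j = not ((var i ⊖ var j) ⊕ (var j ⊖ var i))

-- The sum of N copies of i, plus j: the index of the matrix entry (i , j).
pair : ∀ {n} → Fin n → Fin n → Expr n
pair i j = ∑ (var (suc i)) ⊕ var j

-- Two cells, holding the order and the number of cops, precede the matrix.
adjacent : ∀ {n} → Fin n → Fin n → Expr n
adjacent i j = cell (lit 2 ⊕ pair i j)

-- The first cell after the input, which is to hold the length of the output.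
top : ∀ {n} → Expr n
top = lit 2 ⊕ ∑ (∑ (lit 1))

-- The matrix after the cell top tabulates won positions (cop, robber) of the game with one cop.
won : ∀ {n} → Fin n → Fin n → Expr n
won i j = cell (lit 1 ⊕ top ⊕ pair i j)

reachable : ∀ {n} → Fin n → Fin n → Expr n
reachable i j = adjacent i j ⊕ equals i j

-- One step of retrograde analysis: the cop has a move to some `c′` that captures the robber or
-- after which every answer `r′` leads to a won position. The summand `won c r` preserves earlier
-- marks when the cell is overwritten.
winnable : ∀ {n} → Fin n → Fin n → Expr n
winnable c r = won c r ⊕ ∑ (reachable (suc c) zero and
  (equals zero (suc r) ⊕ every (not (reachable (suc (suc r)) zero) ⊕ won (suc zero) zero)))

-- The table is updated in place, so a round may already use marks made earlier in the same round;
-- this is harmless, as winnability is monotone in the marks.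
updateWins : ∀ {n} → Stmt n
updateWins = for (for (lit 1 ⊕ top ⊕ pair (suc zero) zero := winnable (suc zero) zero))

-- These are `N * N + 1` rounds, one more than there are positions, so some round must find nothing
-- new to mark.
solve : Stmt 0
solve = for (for updateWins) ⨟ updateWins

copWins : Expr 0
copWins = ∑ (every (won (suc zero) zero))

-- Correctness of the retrograde analysis

module Input (I : CopsInstance) where
  open CopsInstance I

  N : ℕ
  N = order

  m₀ : Memory
  m₀ = cells (encodeCops I)

  entry : Vertex → Vertex → ℕ
  entry u v = if does (Adj? u v) then 1 else 0

  row : Vertex → List ℕ
  row u = map (entry u) (allFin N)

  length-row : ∀ u → length (row u) ≡ N
  length-row u = trans (length-map (entry u) (allFin N)) (length-tabulate (λ i → i))

  ⟨_,_⟩ : ℕ → ℕ → ℕ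
  ⟨ i , j ⟩ = sumTo N (λ _ → i) + j

  ⟨,⟩-combine : ∀ (u v : Vertex) → ⟨ toℕ u , toℕ v ⟩ ≡ toℕ (combine u v)
  ⟨,⟩-combine u v = trans (cong (_+ toℕ v) (sumTo-const N (toℕ u))) (sym (toℕ-combine u v))

  ⟨,⟩-injective : ∀ {u v u′ v′ : Vertex} → ⟨ toℕ u , toℕ v ⟩ ≡ ⟨ toℕ u′ , toℕ v′ ⟩ → u ≡ u′ × v ≡ v′
  ⟨,⟩-injective {u} {v} {u′} {v′} eq = combine-injective u v u′ v′
    (toℕ-injective (trans (sym (⟨,⟩-combine u v)) (trans eq (⟨,⟩-combine u′ v′))))

  topCell : ℕ
  topCell = eval N [] m₀ top

  topCell≡ : topCell ≡ 2 + N * N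
  topCell≡ = cong (2 +_) (trans (sumTo-const N _) (cong (N *_) (trans (sumTo-const N 1) (*-identityʳ N))))

  ⟨,⟩<topCell : ∀ u v → 2 + ⟨ toℕ u , toℕ v ⟩ < topCell
  ⟨,⟩<topCell u v = subst₂ (λ a b → 2 + a < b) (sym (⟨,⟩-combine u v)) (sym topCell≡) (s<s (s<s (toℕ<n (combine u v))))

  length-encode : length (encodeCops I) ≡ topCell
  length-encode = trans (cong (2 +_) (length-concatMap (λ i → i) row length-row)) (sym topCell≡)

  m₀-beyond : ∀ {a} → topCell ≤ a → m₀ a ≡ 0
  m₀-beyond le = cells-beyond (encodeCops I) (≤-trans (≤-reflexive length-encode) le)

  m₀-entry : ∀ u v → m₀ (2 + ⟨ toℕ u , toℕ v ⟩) ≡ entry u v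
  m₀-entry u v = begin
    cells (concatMap row (allFin N)) ⟨ toℕ u , toℕ v ⟩
      ≡⟨ cong (cells (concatMap row (allFin N))) (cong (_+ toℕ v) (trans (sumTo-const N (toℕ u)) (*-comm N (toℕ u)))) ⟩
    cells (concatMap row (allFin N)) (toℕ u * N + toℕ v)   ≡⟨ cells-concatMap (λ i → i) row length-row u (toℕ<n v) ⟩
    cells (row u) (toℕ v)                                  ≡⟨ cong (λ xs → cells xs (toℕ v)) (map-tabulate (λ i → i) (entry u)) ⟩
    cells (tabulate (entry u)) (toℕ v)                     ≡⟨ cells-tabulate (entry u) v ⟩
    entry u v                                              ∎
    where open ≡-Reasoning

  Intact : Memory → Set
  Intact m = ∀ {a} → a < topCell → m a ≡ m₀ a

  decides-adjacent : ∀ {m} → Intact m → ∀ u v → m (2 + ⟨ toℕ u , toℕ v ⟩) decides Adj u v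
  decides-adjacent intact u v = subst (_decides Adj u v)
    (sym (trans (intact (⟨,⟩<topCell u v)) (m₀-entry u v))) (decides-if (Adj? u v))

  Step : Vertex → Vertex → Set
  Step u v = Adj u v ⊎ u ≡ v

  step⇒move : ∀ {u v} → Step u v → ReflClosure Adj u v
  step⇒move (inj₁ e)    = along e
  step⇒move (inj₂ refl) = refl

  move⇒step : ∀ {u v} → ReflClosure Adj u v → Step u v
  move⇒step (along e) = inj₁ e
  move⇒step refl  = inj₂ refl

  open Game graph 1

  record Won (m : Memory) (c r : Vertex) : Set where
    constructor is-won
    field
      entry>0 : 0 < m (suc topCell + ⟨ toℕ c , toℕ r ⟩)

  open Won

  decides-won : ∀ {m} c r → m (suc topCell + ⟨ toℕ c , toℕ r ⟩) decides Won m c r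
  decides-won c r = record { sound = is-won ; complete = entry>0 }

  won? : ∀ m c r → Dec (Won m c r)
  won? m c r = decided (decides-won c r)

  Winnable : Memory → Vertex → Vertex → Set
  Winnable m c r = Won m c r ⊎ ∃[ c′ ] Step c c′ × (c′ ≡ r ⊎ ∀ r′ → ¬ Step r r′ ⊎ Won m c′ r′)

  _⊑_ : Memory → Memory → Set
  m ⊑ m′ = ∀ {c r} → Won m c r → Won m′ c r

  winnable-mono : ∀ {m m′ c r} → m ⊑ m′ → Winnable m c r → Winnable m′ c r
  winnable-mono le (inj₁ w) = inj₁ (le w)
  winnable-mono le (inj₂ (c′ , s , inj₁ eq)) = inj₂ (c′ , s , inj₁ eq)
  winnable-mono le (inj₂ (c′ , s , inj₂ f))  =
    inj₂ (c′ , s , inj₂ λ r′ → [ inj₁ , inj₂ ∘ le ]′ (f r′))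

  winnableValue : Memory → ℕ → ℕ → ℕ
  winnableValue m c r = eval N (r ∷ c ∷ []) m (winnable (suc zero) zero)

  decides-step : ∀ {m} → Intact m → ∀ u v →
    eval N (toℕ u ∷ toℕ v ∷ []) m (reachable zero (suc zero)) decides Step u v
  decides-step intact u v = decides-⊎ (decides-adjacent intact u v) (decides-≡ u v)

  decides-winnable : ∀ {m} → Intact m → ∀ c r → winnableValue m (toℕ c) (toℕ r) decides Winnable m c r
  decides-winnable {m} intact c r = decides-⊎ (decides-won c r) (decides-∃ λ c′ →
    decides-× (decides-step intact c c′) (decides-⊎ (decides-≡ c′ r) (decides-∀
      {f = λ r′ → eval N (r′ ∷ toℕ c′ ∷ toℕ r ∷ toℕ c ∷ []) m
             (not (reachable (suc (suc zero)) zero) ⊕ won (suc zero) zero)}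
      λ r′ → decides-⊎ (decides-¬ (decides-step intact r r′)) (decides-won c′ r′))))

  record Sound (m : Memory) : Set where
    field
      intact    : Intact m
      won-sound : ∀ {c r} → Won m c r → CopsToMove (λ _ → c) r

  open Sound

  winnable-sound : ∀ {m c r} → Sound m → Winnable m c r → CopsToMove (λ _ → c) r
  winnable-sound s (inj₁ w) = won-sound s w
  winnable-sound s (inj₂ (c′ , st , inj₁ eq)) =
    move (λ _ → c′) (λ _ → step⇒move st) (caught (zero , eq))
  winnable-sound s (inj₂ (c′ , st , inj₂ f))  =
    move (λ _ → c′) (λ _ → step⇒move st)
      (move λ r′ mv → [ (λ ¬st → contradiction (move⇒step mv) ¬st) , won-sound s ]′ (f r′))

  -- `D` is the set of positions visited between `m` and `m′`. What was winnable at the start is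
  -- marked when visited, whatever else has been marked in between.
  record Progress (D : Vertex → Vertex → Set) (m m′ : Memory) : Set where
    field
      sound′    : Sound m′
      increases : m ⊑ m′
      marks     : ∀ {c r} → D c r → Winnable m c r → Won m′ c r

  open Progress

  progress-trans : ∀ {D D′ m m′ m″} → Progress D m m′ → Progress D′ m′ m″ →
                   Progress (λ c r → D c r ⊎ D′ c r) m m″
  progress-trans p q = record
    { sound′    = sound′ q
    ; increases = increases q ∘ increases p
    ; marks     = λ { (inj₁ d) w → increases q (marks p d w)
                    ; (inj₂ d) w → marks q d (winnable-mono (increases p) w) } }

  progress-iter : ∀ {D : ℕ → Vertex → Vertex → Set} (f : ℕ → Memory → Memory) →
    (∀ (i : Vertex) {m} → Sound m → Progress (D (toℕ i)) m (f (toℕ i) m)) →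
    ∀ n → n ≤ N → ∀ {m} → Sound m → Progress (λ c r → ∃[ i ] i < n × D i c r) m (iter n f m)
  progress-iter f step zero    _   s = record { sound′ = s ; increases = λ w → w ; marks = λ () }
  progress-iter {D} f step (suc n) n<N {m} s = record
    { sound′ = sound′ q ; increases = increases q
    ; marks  = λ { (i , i<1+n , d) → marks q (split i<1+n d) } }
    where
    p = progress-iter f step n (<⇒≤ n<N) s
    q = progress-trans p
      (subst (λ k → Progress (D k) (iter n f m) (f k (iter n f m))) (toℕ-fromℕ< n<N) (step (fromℕ< n<N) (sound′ p)))
    split : ∀ {i c r} → i < suc n → D i c r → (∃[ j ] j < n × D j c r) ⊎ D n c r
    split i<1+n d with m≤n⇒m<n∨m≡n (s≤s⁻¹ i<1+n)
    ... | inj₁ i<n  = inj₁ (_ , i<n , d)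
    ... | inj₂ refl = inj₂ d

  mark : ∀ c r {m} → Sound m → Progress (λ c′ r′ → toℕ c ≡ toℕ c′ × toℕ r ≡ toℕ r′) m
         (m [ suc topCell + ⟨ toℕ c , toℕ r ⟩ ≔ winnableValue m (toℕ c) (toℕ r) ])
  mark c r {m} s = record
    { sound′    = record
      { intact    = λ a< → trans (update-off m (<⇒≢ (<-≤-trans a< (≤-trans (n≤1+n _) (m≤m+n _ _))))) (intact s a<)
      ; won-sound = λ {c′} {r′} w → sound″ c′ r′ w (at? c′ r′) }
    ; increases = λ {c′} {r′} w → increases″ c′ r′ w (at? c′ r′)
    ; marks     = λ { (eq , eq′) w → marks″ (toℕ-injective eq) (toℕ-injective eq′) w } }
    where
    v = winnableValue m (toℕ c) (toℕ r)
    m′ = m [ suc topCell + ⟨ toℕ c , toℕ r ⟩ ≔ v ]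
    d = decides-winnable (intact s) c r
    at? : ∀ c′ r′ → Dec (suc topCell + ⟨ toℕ c′ , toℕ r′ ⟩ ≡ suc topCell + ⟨ toℕ c , toℕ r ⟩)
    at? c′ r′ = _ ≟ _
    at : m′ (suc topCell + ⟨ toℕ c , toℕ r ⟩) ≡ v
    at = update-at m _ v
    same : ∀ {c′ r′} → suc topCell + ⟨ toℕ c′ , toℕ r′ ⟩ ≡ suc topCell + ⟨ toℕ c , toℕ r ⟩ → c′ ≡ c × r′ ≡ r
    same eq = ⟨,⟩-injective (+-cancelˡ-≡ (suc topCell) _ _ eq)
    sound″ : ∀ c′ r′ → Won m′ c′ r′ → Dec _ → CopsToMove (λ _ → c′) r′
    sound″ c′ r′ w (no ≢) = won-sound s (is-won (subst (0 <_) (update-off m ≢) (entry>0 w)))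
    sound″ c′ r′ w (yes eq) with refl , refl ← same eq = winnable-sound s (_decides_.sound d (subst (0 <_) at (entry>0 w)))
    increases″ : ∀ c′ r′ → Won m c′ r′ → Dec _ → Won m′ c′ r′
    increases″ c′ r′ w (no ≢) = is-won (subst (0 <_) (sym (update-off m ≢)) (entry>0 w))
    increases″ c′ r′ w (yes eq) with refl , refl ← same eq = is-won (subst (0 <_) (sym at) (_decides_.complete d (inj₁ w)))
    marks″ : ∀ {c′ r′} → c ≡ c′ → r ≡ r′ → Winnable m c′ r′ → Won m′ c′ r′
    marks″ refl refl w = is-won (subst (0 <_) (sym at) (_decides_.complete d w))

  round : Memory → Memory
  round = exec N [] updateWins

  round-progress : ∀ {m} → Sound m → Progress (λ _ _ → ⊤) m (round m)
  round-progress s = record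
    { sound′    = sound′ p
    ; increases = increases p
    ; marks     = λ {c} {r} _ → marks p (toℕ c , toℕ<n c , toℕ r , toℕ<n r , refl , refl) }
    where
    p = progress-iter {λ i c r → ∃[ j ] j < N × i ≡ toℕ c × j ≡ toℕ r} _
          (λ i → progress-iter {λ j c r → toℕ i ≡ toℕ c × j ≡ toℕ r} _ (λ j → mark i j) N ≤-refl) N ≤-refl s

  Complete : Memory → Set
  Complete m = ∀ {c : Cops} {r} → CopsToMove c r → Won m (c zero) r

  -- Induction on the game tree: by saturation, a position is marked as soon as all answers to the
  -- move of the strategy are.
  saturated⇒complete : ∀ {m} → (∀ c r → Winnable m c r → Won m c r) → Complete m
  saturated⇒complete {m} saturated = cops
    where
    mutual
      cops : Complete m
      -- The table starts empty; a position in which the robber is already caught becomes winnable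
      -- through the cop who stays.
      cops (caught (zero , eq))   = saturated _ _ (inj₂ (_ , inj₂ refl , inj₁ eq))
      cops (move c′ moves w)      = saturated _ _ (inj₂ (c′ zero , move⇒step (moves zero) , robber w))
      robber : ∀ {c : Cops} {r} → RobberToMove c r → c zero ≡ r ⊎ ∀ r′ → ¬ Step r r′ ⊎ Won m (c zero) r′
      robber (caught (zero , eq)) = inj₁ eq
      robber {c} {r} (move w)     = inj₂ λ r′ → answer r′ (Step? r r′)
        where
        Step? : ∀ u v → Dec (Step u v)
        Step? u v = Adj? u v ⊎-dec (u ≟ᶠ v)
        answer : ∀ r′ → Dec (Step r r′) → ¬ Step r r′ ⊎ Won m (c zero) r′
        answer r′ (yes st) = inj₂ (cops (w r′ (step⇒move st)))
        answer r′ (no ¬st) = inj₁ ¬st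

  wonAt? : ∀ m (x : Fin (N * N)) → Dec (uncurry (Won m) (remQuot N x))
  wonAt? m x = uncurry (won? m) (remQuot N x)

  wonSet : Memory → Subset (N * N)
  wonSet m = subset (wonAt? m)

  wonSet-grows : ∀ {m m′} → m ⊑ m′ → (∃[ c ] ∃[ r ] ¬ Won m c r × Won m′ c r) → ∣ wonSet m ∣ < ∣ wonSet m′ ∣
  wonSet-grows {m} {m′} le (c , r , ¬w , w) = p⊂q⇒∣p∣<∣q∣
    ((λ x∈ → ∈-subset⁺ (wonAt? m′) (le (∈-subset⁻ (wonAt? m) x∈))) ,
     combine c r , ∈-subset⁺ (wonAt? m′) (subst (uncurry (Won m′)) (sym (remQuot-combine c r)) w) ,
     λ x∈ → ¬w (subst (uncurry (Won m)) (remQuot-combine c r) (∈-subset⁻ (wonAt? m) x∈)))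

  record Stage (t : ℕ) (m : Memory) : Set where
    field
      sound-stage : Sound m
      advance     : Complete m ⊎ t ≤ ∣ wonSet m ∣

  open Stage

  -- A round either finds every position saturated or adds one of the N * N positions.
  stage-round : ∀ {t m} → Stage t m → Stage (suc t) (round m)
  stage-round {t} {m} s = record { sound-stage = sound′ p ; advance = next (advance s) }
    where
    p = round-progress (sound-stage s)
    saturated? : Dec (∀ c → ∀ r → Winnable m c r → Won m c r)
    saturated? = all? λ c → all? λ r → decided (decides-winnable (intact (sound-stage s)) c r) →-dec won? m c r
    next : Complete m ⊎ t ≤ ∣ wonSet m ∣ → Complete (round m) ⊎ suc t ≤ ∣ wonSet (round m) ∣
    next (inj₁ complete) = inj₁ λ w → increases p (complete w)
    next (inj₂ t≤) with saturated?
    ... | yes sat = inj₁ λ w → increases p (saturated⇒complete {m} sat w)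
    ... | no ¬sat = inj₂ (≤-<-trans t≤ (wonSet-grows (increases p) unsaturated))
      where
      unsaturated : ∃[ c ] ∃[ r ] ¬ Won m c r × Won (round m) c r
      unsaturated with c , ¬row ← ¬∀⟶∃¬ N _ (λ c → all? λ r → decided (decides-winnable (intact (sound-stage s)) c r) →-dec won? m c r) ¬sat
        with r , ¬w ← ¬∀⟶∃¬ N _ (λ r → decided (decides-winnable (intact (sound-stage s)) c r) →-dec won? m c r) ¬row
        with decided (decides-winnable (intact (sound-stage s)) c r)
      ... | yes win = c , r , (λ w → ¬w λ _ → w) , marks p _ win
      ... | no ¬win = contradiction (λ win → contradiction win ¬win) ¬w

  -- One application of `f` comprises `d` rounds; the lemma serves for the inner loop with `d = 1`
  -- and for the outer loop with `d = N * 1`.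
  stage-iter : ∀ (f : Memory → Memory) d → (∀ {t m} → Stage t m → Stage (d + t) (f m)) →
               ∀ n {t m} → Stage t m → Stage (n * d + t) (iter n (λ _ → f) m)
  stage-iter f d step zero    s = s
  stage-iter f d step (suc n) {t} {m} s = subst (λ k → Stage k (f (iter n (λ _ → f) m))) (sym (+-assoc d (n * d) t)) (step (stage-iter f d step n s))

  stage-solve : Stage (suc (N * (N * 1) + 0)) (exec N [] solve m₀)
  stage-solve = stage-round (stage-iter (iter N (λ _ → round)) (N * 1) (stage-iter round 1 stage-round N) N start)
    where
    start : Stage 0 m₀
    start = record
      { sound-stage = record
        { intact    = λ _ → refl
        ; won-sound = λ w → contradiction (subst (0 <_) (m₀-beyond (≤-trans (n≤1+n _) (m≤m+n _ _))) (entry>0 w)) λ () }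
      ; advance     = inj₂ z≤n }

  solved : Memory
  solved = exec N [] solve m₀

  solved-intact : Intact solved
  solved-intact = intact (sound-stage stage-solve)

  decides-solved : ∀ c r → solved (suc topCell + ⟨ toℕ c , toℕ r ⟩) decides CopsToMove (λ _ → c) r
  decides-solved c r = record { sound = λ w → won-sound (sound-stage stage-solve) (is-won w) ; complete = λ w → entry>0 (complete′ (advance stage-solve) w) }
    where
    complete′ : Complete solved ⊎ suc (N * (N * 1) + 0) ≤ ∣ wonSet solved ∣ → CopsToMove (λ _ → c) r → Won solved c r
    complete′ (inj₁ f)  = f
    -- At most `N * N` positions can be won, so a count above that is impossible.
    complete′ (inj₂ le) = contradiction (≤-trans le (∣p∣≤n (wonSet solved)))
      (<⇒≱ (s≤s (≤-reflexive (sym (trans (+-identityʳ _) (cong (N *_) (*-identityʳ N)))))))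

  copWinsValue : ℕ
  copWinsValue = eval N [] solved copWins

  decides-copWins : copWinsValue decides CopWin
  decides-copWins = decides-⇔
    (λ (c , win) → (λ _ → c) , win)
    (λ (c , win) → c zero , λ r → cong-cops (win r))
    (decides-∃ λ c → decides-∀ {f = λ r → solved (suc topCell + ⟨ toℕ c , r ⟩)} λ r → decides-solved c r)
    where
    -- A placement of the single cop agrees with the constant function only pointwise, so the first
    -- move of the strategy is retyped.
    cong-cops : ∀ {c : Cops} {r} → CopsToMove c r → CopsToMove (λ _ → c zero) r
    cong-cops (caught (zero , eq)) = caught (zero , eq)
    cong-cops (move c′ moves w)    = move c′ (λ { zero → moves zero }) w

-- Restriction to the kept vertices

dominatedBy : ∀ {n} → Fin n → Fin n → Expr n
dominatedBy i j = every (not (adjacent (suc i) zero) ⊕ adjacent (suc j) zero)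

kept : ∀ {n} → Fin n → Expr n
kept i = not (∑ (dominatedBy (suc i) zero and
  (not (dominatedBy zero (suc i)) ⊕ (var zero ⊖ var (suc i)))))

-- After markKept, the array after the cell top marks the kept vertices.
marked : ∀ {n} → Fin n → Expr n
marked i = cell (lit 1 ⊕ top ⊕ var i)

markKept : Stmt 0
markKept = for (lit 1 ⊕ top ⊕ var zero := kept zero)

-- The submatrix of the kept vertices is written over the adjacency matrix, with top as write
-- pointer; an entry that is not to stay is written as well, but the pointer is not advanced.
compact : Stmt 0
compact = for (for (
  cell top := adjacent (suc zero) zero ⨟
  top := cell top ⊕ marked (suc zero) and marked zero))

-- Loop lengths come from the register holding `N`, so cell 0 may be overwritten; the marks lie
-- beyond the cell `top` and still give the number of kept vertices after the compaction.
restrictToKept : Stmt 0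
restrictToKept =
  markKept ⨟
  top := lit 2 ⨟
  compact ⨟
  lit 1 := minimum (cell (lit 1)) (∑ (marked zero)) ⨟
  lit 0 := ∑ (marked zero)

m∸[m∸n]≡m⊓n : ∀ m n → m ∸ (m ∸ n) ≡ m ⊓ n
m∸[m∸n]≡m⊓n m n with ≤-total m n
... | inj₁ m≤n rewrite m≤n⇒m∸n≡0 m≤n = sym (m≤n⇒m⊓n≡m m≤n)
... | inj₂ n≤m = trans (m∸[m∸n]≡n n≤m) (sym (m≥n⇒m⊓n≡n n≤m))

cells-∷ʳ : ∀ xs x → cells (xs ∷ʳ x) (length xs) ≡ x
cells-∷ʳ xs x = trans (cong (cells (xs ∷ʳ x)) (sym (+-identityʳ (length xs)))) (cells-++ʳ xs [ x ] 0)

map-toℕ-allFin : ∀ n → map toℕ (allFin n) ≡ upTo n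
map-toℕ-allFin n = trans (map-tabulate {n = n} (λ i → i) toℕ) (go n (λ i → i))
  where
  go : ∀ n (f : ℕ → ℕ) → tabulate {n = n} (f ∘ toℕ) ≡ applyUpTo f n
  go zero    f = refl
  go (suc n) f = cong (f 0 ∷_) (go n (f ∘ suc))

filter-map : ∀ {A : Set} {P : ℕ → Set} (P? : ∀ n → Dec (P n)) (f : A → ℕ) xs →
             filter P? (map f xs) ≡ map f (filter (P? ∘ f) xs)
filter-map P? f []       = refl
filter-map P? f (x ∷ xs) with does (P? (f x))
... | true  = cong (f x ∷_) (filter-map P? f xs)
... | false = filter-map P? f xs

-- The kept graph is encoded by positions in the list of kept vertices, whereas the program runs
-- over the kept vertices themselves.
concatMap-lookup : ∀ {A : Set} (g : A → A → ℕ) (xs : List A) →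
  concatMap (λ a → map (λ b → g (lookup xs a) (lookup xs b)) (allFin (length xs))) (allFin (length xs)) ≡
  concatMap (λ a → map (g a) xs) xs
concatMap-lookup g xs = begin
  concatMap (λ a → map (λ b → g (lookup xs a) (lookup xs b)) is) is
    ≡⟨ concatMap-cong (λ a → trans (map-∘ is) (cong (map (g (lookup xs a))) lookups)) is ⟩
  concatMap (λ a → map (g (lookup xs a)) xs) is   ≡⟨ concatMap-map (λ a → map (g a) xs) (lookup xs) is ⟨
  concatMap (λ a → map (g a) xs) (map (lookup xs) is)   ≡⟨ cong (concatMap (λ a → map (g a) xs)) lookups ⟩
  concatMap (λ a → map (g a) xs) xs ∎
  where
  open ≡-Reasoning
  is = allFin (length xs)
  lookups : map (lookup xs) is ≡ xs
  lookups = trans (map-tabulate (λ i → i) (lookup xs)) (tabulate-lookup xs)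

-- Correctness of the restriction program

module Restrict (I : CopsInstance) where
  open CopsInstance I
  open Input I
  open Domination graph

  decides-dominates : ∀ {m} → Intact m → ∀ u v →
    eval N (toℕ v ∷ toℕ u ∷ []) m (dominatedBy zero (suc zero)) decides Dominates u v
  decides-dominates {m} intact u v = decides-⇔ (λ p w a → [ (λ ¬a → contradiction a ¬a) , (λ b → b) ]′ (p w))
    (λ d w → split d w (Adj? v w))
    (decides-∀ {f = λ w → eval N (w ∷ toℕ v ∷ toℕ u ∷ []) m
        (not (adjacent (suc zero) zero) ⊕ adjacent (suc (suc zero)) zero)}
      λ w → decides-⊎ (decides-¬ (decides-adjacent intact v w)) (decides-adjacent intact u w))
    where
    split : Dominates u v → ∀ w → Dec (Adj v w) → ¬ Adj v w ⊎ Adj u w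
    split d w (yes a) = inj₂ (d w a)
    split d w (no ¬a) = inj₁ ¬a

  decides-kept : ∀ {m} → Intact m → ∀ u → eval N (toℕ u ∷ []) m (kept zero) decides Kept u
  decides-kept intact u = decides-¬ (decides-∃ λ v →
    decides-× (decides-dominates intact v u) (decides-⊎ (decides-¬ (decides-dominates intact u v)) decides-<))

  record Marked (n : ℕ) (m : Memory) : Set where
    field
      intact : Intact m
      bit    : ∀ u → toℕ u < n → m (suc topCell + toℕ u) ≡ (if does (kept? u) then 1 else 0)

  markKept-correct : Marked N (exec N [] markKept m₀)
  markKept-correct = go N ≤-refl
    where
    go : ∀ n → n ≤ N → Marked n (iter n (λ i → exec N (i ∷ []) (lit 1 ⊕ top ⊕ var zero := kept zero)) m₀)
    go zero    _   = record { intact = λ _ → refl ; bit = λ _ () }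
    go (suc n) n<N = record
      { intact = λ a< → trans (update-off m (<⇒≢ (<-≤-trans a< (≤-trans (n≤1+n _) (m≤m+n _ n))))) (intact a<)
      ; bit    = λ u u<1+n → bit′ u u<1+n (m≤n⇒m<n∨m≡n (s≤s⁻¹ u<1+n)) }
      where
      open Marked (go n (<⇒≤ n<N))
      m  = iter n (λ i → exec N (i ∷ []) (lit 1 ⊕ top ⊕ var zero := kept zero)) m₀
      m′ = m [ suc topCell + n ≔ eval N (n ∷ []) m (kept zero) ]
      bit′ : ∀ u → toℕ u < suc n → toℕ u < n ⊎ toℕ u ≡ n → m′ (suc topCell + toℕ u) ≡ (if does (kept? u) then 1 else 0)
      bit′ u _ (inj₁ u<n) = trans (update-off m (<⇒≢ (+-monoʳ-< (suc topCell) u<n))) (bit u u<n)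
      bit′ u _ (inj₂ refl) = trans (update-at m (suc topCell + toℕ u) _)
        (decided-value (decides-kept intact u) (1∸n≤1 (sumTo N _)) (kept? u))

  m₁ : Memory
  m₁ = exec N [] markKept m₀

  open Marked markKept-correct

  κ : ℕ → ℕ
  κ i = m₁ (suc topCell + i)

  κ-kept : ∀ u → κ (toℕ u) ≡ (if does (kept? u) then 1 else 0)
  κ-kept u = bit u (toℕ<n u)

  κ≤1 : ∀ {i} → i < N → κ i ≤ 1
  κ≤1 i<N = subst (λ i → κ i ≤ 1) (toℕ-fromℕ< i<N) (subst (_≤ 1) (sym (κ-kept (fromℕ< i<N))) (if≤1 (does (kept? (fromℕ< i<N)))))
    where
    if≤1 : ∀ b → (if b then 1 else 0) ≤ 1
    if≤1 true  = ≤-refl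
    if≤1 false = z≤n

  κ? : ∀ i → Dec (0 < κ i)
  κ? i = 0 <? κ i

  selected : ℕ → List ℕ
  selected n = filter κ? (upTo n)

  selected-suc : ∀ n → selected (suc n) ≡ selected n ++ filter κ? [ n ]
  selected-suc n = trans (cong (filter κ?) (sym (upTo-∷ʳ n))) (filter-++ κ? (upTo n) [ n ])

  selected-yes : ∀ {n} → 0 < κ n → selected (suc n) ≡ selected n ∷ʳ n
  selected-yes {n} p = trans (selected-suc n) (cong (selected n ++_) (filter-accept κ? p))

  selected-no : ∀ {n} → ¬ 0 < κ n → selected (suc n) ≡ selected n
  selected-no {n} p = trans (selected-suc n) (trans (cong (selected n ++_) (filter-reject κ? p)) (++-identityʳ _))

  sum-κ : ∀ n → n ≤ N → sumTo n κ ≡ length (selected n)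
  sum-κ zero    _   = refl
  sum-κ (suc n) n<N with κ? n
  ... | yes p rewrite selected-yes p | length-++ (selected n) {[ n ]} =
    trans (cong₂ _+_ (≤-antisym (κ≤1 n<N) p) (sum-κ n (<⇒≤ n<N))) (+-comm 1 _)
  ... | no ¬p rewrite selected-no ¬p = cong₂ _+_ (n≤0⇒n≡0 (≮⇒≥ ¬p)) (sum-κ n (<⇒≤ n<N))

  selected-keptList : selected N ≡ map toℕ keptList
  selected-keptList = begin
    filter κ? (upTo N)                       ≡⟨ cong (filter κ?) (map-toℕ-allFin N) ⟨
    filter κ? (map toℕ (allFin N))           ≡⟨ filter-map κ? toℕ (allFin N) ⟩
    map toℕ (filter (κ? ∘ toℕ) (allFin N))   ≡⟨ cong (map toℕ) (filter-≐ (κ? ∘ toℕ) kept? (to , from) (allFin N)) ⟩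
    map toℕ keptList                         ∎
    where
    open ≡-Reasoning
    to : ∀ {u} → 0 < κ (toℕ u) → Kept u
    to {u} p = _decides_.sound (decides-if (kept? u)) (subst (0 <_) (κ-kept u) p)
    from : ∀ {u} → Kept u → 0 < κ (toℕ u)
    from {u} p = subst (0 <_) (sym (κ-kept u)) (_decides_.complete (decides-if (kept? u)) p)

  source : ℕ → ℕ → ℕ
  source i j = m₀ (2 + ⟨ i , j ⟩)

  rowOf : ℕ → ℕ → List ℕ
  rowOf i n = map (source i) (selected n)

  rows : ℕ → List ℕ
  rows n = concatMap (λ i → rowOf i N) (selected n)

  rows-yes : ∀ {n} → 0 < κ n → rows (suc n) ≡ rows n ++ rowOf n N
  rows-yes {n} p = trans (cong (concatMap (λ i → rowOf i N)) (selected-yes p))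
    (trans (concatMap-++ (λ i → rowOf i N) (selected n) [ n ]) (cong (rows n ++_) (++-identityʳ _)))

  rows-keptGraph : rows N ≡ concatMap (λ u → map (entry u) keptList) keptList
  rows-keptGraph = begin
    concatMap (λ i → map (source i) (selected N)) (selected N)
      ≡⟨ cong (λ xs → concatMap (λ i → map (source i) xs) xs) selected-keptList ⟩
    concatMap (λ i → map (source i) (map toℕ keptList)) (map toℕ keptList)
      ≡⟨ concatMap-map (λ i → map (source i) (map toℕ keptList)) toℕ keptList ⟩
    concatMap (λ u → map (source (toℕ u)) (map toℕ keptList)) keptList
      ≡⟨ concatMap-cong (λ u → trans (sym (map-∘ keptList)) (map-cong (m₀-entry u) keptList)) keptList ⟩
    concatMap (λ u → map (entry u) keptList) keptList ∎
    where open ≡-Reasoning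

  -- The memory when the first p entries of the matrix have been processed and those in xs kept.
  record Compacted (p : ℕ) (xs : List ℕ) (m : Memory) : Set where
    field
      pointer  : m topCell ≡ 2 + length xs
      written  : ∀ {i} → i < length xs → m (2 + i) ≡ cells xs i
      short    : length xs ≤ p
      unread   : ∀ {a} → 2 + p ≤ a → a < topCell → m a ≡ m₀ a
      marks    : ∀ i → m (suc topCell + i) ≡ κ i
      cops     : m 1 ≡ k

  open Compacted

  compactStep : ℕ → ℕ → Memory → Memory
  compactStep i j = exec N (j ∷ i ∷ [])
    (cell top := adjacent (suc zero) zero ⨟
     top := cell top ⊕ marked (suc zero) and marked zero)

  keeps : ℕ → ℕ → ℕ
  keeps x y = 1 ∸ ((1 ∸ x) + (1 ∸ y))

  decides-keeps : ∀ i j → keeps (κ i) (κ j) decides (0 < κ i × 0 < κ j)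
  decides-keeps i j = decides-× decides-pos decides-pos

  module _ {p xs m} i j (p≡ : p ≡ ⟨ i , j ⟩) (p< : 2 + p < topCell) (c : Compacted p xs m) where

    private
      ptr = m topCell
      x   = m (2 + ⟨ i , j ⟩)
      m₂  = m [ ptr ≔ x ]
      v   = m₂ topCell + keeps (m₂ (suc topCell + i)) (m₂ (suc topCell + j))
      m₃  = m₂ [ topCell ≔ v ]

      -- The write pointer never passes the entry being read, so no entry is lost before it is read,
      -- and neither the pointer cell nor the marks are hit.
      ptr≤ : ptr ≤ 2 + p
      ptr≤ = ≤-trans (≤-reflexive (pointer c)) (+-monoʳ-≤ 2 (short c))

      x≡ : x ≡ source i j
      x≡ = unread c (≤-reflexive (cong (2 +_) p≡)) (subst (λ p → 2 + p < topCell) p≡ p<)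

      high : ∀ {a} → 2 + p < a → a ≢ topCell → m₃ a ≡ m a
      high lt ne = trans (update-off m₂ ne) (update-off m (≢-sym (<⇒≢ (≤-<-trans ptr≤ lt))))

      low : ∀ {a} → a < ptr → m₃ a ≡ m a
      low lt = trans (update-off m₂ (<⇒≢ (<-≤-trans lt (≤-trans ptr≤ (<⇒≤ p<))))) (update-off m (<⇒≢ lt))

      marks₂ : ∀ i → m₂ (suc topCell + i) ≡ κ i
      marks₂ i = trans (update-off m (≢-sym (<⇒≢ (≤-<-trans ptr≤ (<-trans p< (s≤s (m≤m+n topCell i))))))) (marks c i)

      pointer₃ : m₃ topCell ≡ 2 + length xs + keeps (κ i) (κ j)
      pointer₃ = trans (update-at m₂ topCell v) (cong₂ _+_
        (trans (update-off m (≢-sym (<⇒≢ (≤-<-trans ptr≤ p<)))) (pointer c))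
        (cong₂ keeps (marks₂ i) (marks₂ j)))

      below-pointer : ∀ {n} → n < length xs → 2 + n < ptr
      below-pointer lt = ≤-trans (s<s (s<s lt)) (≤-reflexive (sym (pointer c)))

      unread₃ : ∀ {a} → 2 + suc p ≤ a → a < topCell → m₃ a ≡ m₀ a
      unread₃ le a< = trans (high le (<⇒≢ a<)) (unread c (<⇒≤ le) a<)

      marks₃ : ∀ i → m₃ (suc topCell + i) ≡ κ i
      marks₃ i = trans (update-off m₂ (≢-sym (<⇒≢ (s≤s (m≤m+n topCell i))))) (marks₂ i)

      cops₃ : m₃ 1 ≡ k
      cops₃ = trans (low (subst (1 <_) (sym (pointer c)) (s≤s (s≤s z≤n)))) (cops c)

    compact-keep : 0 < κ i × 0 < κ j → Compacted (suc p) (xs ∷ʳ source i j) (compactStep i j m)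
    compact-keep both = record
      { pointer = trans pointer₃ (trans (cong (2 + length xs +_) (≤-antisym (1∸n≤1 ((1 ∸ κ i) + (1 ∸ κ j))) (_decides_.complete (decides-keeps i j) both)))
                    (trans (+-assoc 2 (length xs) 1) (cong (2 +_) (sym (length-++ xs)))))
      ; written = λ {n} n< → written₃ n (m≤n⇒m<n∨m≡n (s≤s⁻¹ (subst (n <_) length∷ʳ n<)))
      ; short   = subst (_≤ suc p) (sym length∷ʳ) (s≤s (short c))
      ; unread  = unread₃
      ; marks   = marks₃
      ; cops    = cops₃ }
      where
      length∷ʳ : length (xs ∷ʳ source i j) ≡ suc (length xs)
      length∷ʳ = trans (length-++ xs) (+-comm (length xs) 1)
      written₃ : ∀ n → n < length xs ⊎ n ≡ length xs → m₃ (2 + n) ≡ cells (xs ∷ʳ source i j) n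
      written₃ n (inj₁ n<)   = trans (low (below-pointer n<)) (trans (written c n<) (sym (cells-++ˡ xs _ n<)))
      written₃ n (inj₂ refl) = trans
        (update-off m₂ (<⇒≢ (≤-<-trans (≤-trans (≤-reflexive (sym (pointer c))) ptr≤) p<)))
        (trans (trans (cong m₂ (sym (pointer c))) (update-at m ptr x)) (trans x≡ (sym (cells-∷ʳ xs _))))

    compact-drop : ¬ (0 < κ i × 0 < κ j) → Compacted (suc p) xs (compactStep i j m)
    compact-drop ¬both = record
      { pointer = trans pointer₃ (trans (cong (2 + length xs +_)
                    (n≤0⇒n≡0 (≮⇒≥ (¬both ∘ _decides_.sound (decides-keeps i j))))) (+-identityʳ _))
      ; written = λ n< → trans (low (below-pointer n<)) (written c n<)
      ; short   = ≤-trans (short c) (n≤1+n p)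
      ; unread  = unread₃
      ; marks   = marks₃
      ; cops    = cops₃ }

  ⟨,⟩<top : ∀ {i j} → i < N → j < N → 2 + ⟨ i , j ⟩ < topCell
  ⟨,⟩<top i<N j<N = subst₂ (λ i j → 2 + ⟨ i , j ⟩ < topCell) (toℕ-fromℕ< i<N) (toℕ-fromℕ< j<N)
    (⟨,⟩<topCell (fromℕ< i<N) (fromℕ< j<N))

  ⟨,suc⟩ : ∀ i j → ⟨ i , suc j ⟩ ≡ suc ⟨ i , j ⟩
  ⟨,suc⟩ i j = +-suc _ j

  ⟨suc,0⟩ : ∀ i → ⟨ suc i , 0 ⟩ ≡ ⟨ i , N ⟩
  ⟨suc,0⟩ i = begin
    sumTo N (λ _ → suc i) + 0   ≡⟨ +-identityʳ _ ⟩
    sumTo N (λ _ → suc i)       ≡⟨ sumTo-const N (suc i) ⟩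
    N * suc i                   ≡⟨ *-suc N i ⟩
    N + N * i                   ≡⟨ +-comm N (N * i) ⟩
    N * i + N                   ≡⟨ cong (_+ N) (sumTo-const N i) ⟨
    sumTo N (λ _ → i) + N       ∎
    where open ≡-Reasoning

  compact-row : ∀ {i xs m} → i < N → 0 < κ i → Compacted ⟨ i , 0 ⟩ xs m → ∀ n → n ≤ N →
                Compacted ⟨ i , n ⟩ (xs ++ rowOf i n) (iter n (compactStep i) m)
  compact-row {i} {xs} i<N κi c zero n≤N = subst (λ ys → Compacted _ ys _) (sym (++-identityʳ xs)) c
  compact-row {i} {xs} {m} i<N κi c (suc n) n<N with κ? n
  ... | yes κn = subst₂ (λ p ys → Compacted p ys (iter (suc n) (compactStep i) m)) (sym (⟨,suc⟩ i n))
    (trans (++-assoc xs (rowOf i n) _)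
      (cong (xs ++_) (trans (sym (map-++ (source i) (selected n) [ n ])) (cong (map (source i)) (sym (selected-yes κn))))))
    (compact-keep i n refl (⟨,⟩<top i<N n<N) (compact-row i<N κi c n (<⇒≤ n<N)) (κi , κn))
  ... | no ¬κn = subst₂ (λ p ys → Compacted p ys (iter (suc n) (compactStep i) m)) (sym (⟨,suc⟩ i n))
    (cong (λ ys → xs ++ map (source i) ys) (sym (selected-no ¬κn)))
    (compact-drop i n refl (⟨,⟩<top i<N n<N) (compact-row i<N κi c n (<⇒≤ n<N)) (¬κn ∘ proj₂))

  compact-row-drop : ∀ {i xs m} → i < N → ¬ 0 < κ i → Compacted ⟨ i , 0 ⟩ xs m → ∀ n → n ≤ N →
                     Compacted ⟨ i , n ⟩ xs (iter n (compactStep i) m)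
  compact-row-drop i<N ¬κi c zero    n≤N = c
  compact-row-drop {i} {xs} {m} i<N ¬κi c (suc n) n<N = subst (λ p → Compacted p xs (iter (suc n) (compactStep i) m)) (sym (⟨,suc⟩ i n))
    (compact-drop i n refl (⟨,⟩<top i<N n<N) (compact-row-drop i<N ¬κi c n (<⇒≤ n<N)) (¬κi ∘ proj₁))

  compactRow : ℕ → Memory → Memory
  compactRow i = iter N (compactStep i)

  compact-rows : ∀ {m} → Compacted ⟨ 0 , 0 ⟩ [] m → ∀ n → n ≤ N → Compacted ⟨ n , 0 ⟩ (rows n) (iter n compactRow m)
  compact-rows c zero    n≤N = c
  compact-rows {m} c (suc n) n<N with κ? n
  ... | yes κn = subst₂ (λ p ys → Compacted p ys (iter (suc n) compactRow m)) (sym (⟨suc,0⟩ n)) (sym (rows-yes κn))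
    (compact-row n<N κn (compact-rows c n (<⇒≤ n<N)) N ≤-refl)
  ... | no ¬κn = subst₂ (λ p ys → Compacted p ys (iter (suc n) compactRow m)) (sym (⟨suc,0⟩ n))
    (cong (concatMap (λ i → rowOf i N)) (sym (selected-no ¬κn)))
    (compact-row-drop n<N ¬κn (compact-rows c n (<⇒≤ n<N)) N ≤-refl)

  ready : Memory
  ready = m₁ [ topCell ≔ 2 ]

  start : Compacted ⟨ 0 , 0 ⟩ [] ready
  start = record
    { pointer = update-at m₁ topCell 2
    ; written = λ ()
    ; short   = z≤n
    ; unread  = λ _ a< → trans (update-off m₁ (<⇒≢ a<)) (intact a<)
    ; marks   = λ i → update-off m₁ (≢-sym (<⇒≢ (s≤s (m≤m+n topCell i))))
    ; cops    = intact (s≤s (s≤s z≤n)) }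

  packed : Memory
  packed = exec N [] compact ready

  compacted : Compacted ⟨ N , 0 ⟩ (rows N) packed
  compacted = compact-rows start N ≤-refl

  final : Memory
  final = exec N [] restrictToKept m₀

  keptInstance : CopsInstance
  keptInstance = record
    { graph     = keptGraph
    ; connected = retract-connected connected
    ; hasEdge   = keptGraph-hasEdge hasEdge
    ; k         = k ⊓ Graph.order keptGraph }

  sumTo-cong : ∀ n {f g : ℕ → ℕ} → (∀ i → f i ≡ g i) → sumTo n f ≡ sumTo n g
  sumTo-cong zero    eq = refl
  sumTo-cong (suc n) eq = cong₂ _+_ (eq n) (sumTo-cong n eq)

  order≡ : sumTo N κ ≡ length keptList
  order≡ = trans (sum-κ N ≤-refl) (trans (cong length selected-keptList) (length-map toℕ keptList))

  encode-kept : encodeCops keptInstance ≡ length keptList ∷ k ⊓ length keptList ∷ rows N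
  encode-kept = cong (λ xs → length keptList ∷ k ⊓ length keptList ∷ xs)
    (trans (concatMap-lookup entry keptList) (sym rows-keptGraph))

  final-length : final topCell ≡ length (encodeCops keptInstance)
  final-length = trans (pointer compacted) (sym (cong length encode-kept))

  final-correct : ∀ i → i < length (encodeCops keptInstance) → final i ≡ cells (encodeCops keptInstance) i
  final-correct i i< = trans (go i (subst (λ xs → i < length xs) encode-kept i<)) (cong (λ xs → cells xs i) (sym encode-kept))
    where
    count : sumTo N (λ i → packed (suc topCell + i)) ≡ length keptList
    count = trans (sumTo-cong N (marks compacted)) order≡
    go : ∀ i → i < 2 + length (rows N) → final i ≡ cells (length keptList ∷ k ⊓ length keptList ∷ rows N) i
    go zero          _  = trans (sumTo-cong N (λ i → marks compacted i)) order≡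
    go (suc zero)    _  = trans (cong₂ (λ a b → a ∸ (a ∸ b)) (cops compacted) count) (m∸[m∸n]≡m⊓n k (length keptList))
    go (suc (suc i)) i< = written compacted (s≤s⁻¹ (s≤s⁻¹ i<))

-- The kernel

-- The complete graph on two vertices: one cop wins on it and no cops lose, so the number of cops
-- can encode either answer.
edgeGraph : Graph
edgeGraph = record
  { order  = 2
  ; Adj    = λ u v → u ≢ v
  ; Adj?   = λ u v → ¬? (u ≟ᶠ v)
  ; irrefl = λ eq neq → neq eq
  ; symm   = ≢-sym }

edgeGraph-connected : Graph.Connected edgeGraph
edgeGraph-connected u v with u ≟ᶠ v
... | yes refl = ε
... | no  u≢v  = u≢v ◅ ε

edgeInstance : ℕ → CopsInstance
edgeInstance k = record
  { graph     = edgeGraph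
  ; connected = edgeGraph-connected
  ; hasEdge   = zero , suc zero , λ ()
  ; k         = k }

edgeGraph-copwin : Game.CopWin edgeGraph 1
edgeGraph-copwin = (λ _ → zero) , λ where
  zero       → Game.caught (zero , refl)
  (suc zero) → Game.move (λ _ → suc zero) (λ _ → along λ ()) (Game.caught (zero , refl))

-- For `k ≤ 1` the minimum is 1 exactly when `k = 1` and one cop wins, however large the sum
-- `copWins` is. The remaining cells receive the order 2 and the matrix 0, 1, 1, 0; the word has
-- length 6.
toEdge : Stmt 0
toEdge =
  solve ⨟
  lit 1 := minimum (cell (lit 1)) copWins ⨟
  top   := lit 6 ⨟
  lit 0 := lit 2 ⨟
  lit 2 := lit 0 ⨟
  lit 3 := lit 1 ⨟
  lit 4 := lit 1 ⨟
  lit 5 := lit 0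

kernelize : Stmt 0
kernelize = choose (cell (lit 1) ⊖ lit 1) restrictToKept toEdge

reduction : CopsInstance → CopsInstance
reduction I = if⁺ CopsInstance.k I ∸ 1 then Restrict.keptInstance I
              else edgeInstance (CopsInstance.k I ⊓ Input.copWinsValue I)

-- An edge has two distinct ends, so `2 + N * N` is at least 6 and the six output cells do not
-- collide with the cell holding the length.
topCell>5 : ∀ I {i} → i < 6 → i < Input.topCell I
topCell>5 I {i} i<6 = <-≤-trans i<6 (≤-trans (+-monoʳ-≤ 2 (*-mono-≤ 2≤N 2≤N)) (≤-reflexive (sym (Input.topCell≡ I))))
  where
  open CopsInstance I
  two : ∀ {n} (u v : Fin n) → u ≢ v → 2 ≤ n
  two {suc zero}    zero zero u≢v = contradiction refl u≢v
  two {suc (suc n)} _ _ _ = s≤s (s≤s z≤n)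
  2≤N : 2 ≤ order
  2≤N = two (proj₁ hasEdge) (proj₁ (proj₂ hasEdge)) λ eq → irrefl eq (proj₂ (proj₂ hasEdge))

toEdge-correct : ∀ I → let open Input I; open CopsInstance I; m = exec N [] toEdge m₀; ys = encodeCops (edgeInstance (k ⊓ copWinsValue)) in
  m topCell ≡ length ys × (∀ i → i < length ys → m i ≡ cells ys i)
toEdge-correct I = length-correct , λ i i< → correct i i<
  where
  open Input I
  open CopsInstance I
  m = exec N [] toEdge m₀
  m₅ : Memory
  m₅ = solved [ 1 ≔ solved 1 ∸ (solved 1 ∸ copWinsValue) ]
  m₆ : Memory
  m₆ = m₅ [ topCell ≔ 6 ]
  off : ∀ i (f : Memory) v → i < 6 → (f [ i ≔ v ]) topCell ≡ f topCell
  off i f v i<6 = update-off f (≢-sym (<⇒≢ (topCell>5 I i<6)))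
  m₇ = m₆ [ 0 ≔ 2 ]
  m₈ = m₇ [ 2 ≔ 0 ]
  m₉ = m₈ [ 3 ≔ 1 ]
  m₁₀ = m₉ [ 4 ≔ 1 ]
  length-correct : m topCell ≡ 6
  length-correct = begin
    (m₁₀ [ 5 ≔ 0 ]) topCell   ≡⟨ off 5 m₁₀ 0 (≤ᵇ⇒≤ _ _ _) ⟩
    m₁₀ topCell               ≡⟨ off 4 m₉ 1 (≤ᵇ⇒≤ _ _ _) ⟩
    m₉ topCell                ≡⟨ off 3 m₈ 1 (≤ᵇ⇒≤ _ _ _) ⟩
    m₈ topCell                ≡⟨ off 2 m₇ 0 (≤ᵇ⇒≤ _ _ _) ⟩
    m₇ topCell                ≡⟨ off 0 m₆ 2 (≤ᵇ⇒≤ _ _ _) ⟩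
    m₆ topCell                ≡⟨ update-at m₅ topCell 6 ⟩
    6                         ∎
    where open ≡-Reasoning
  correct : ∀ i → i < 6 → m i ≡ cells (encodeCops (edgeInstance (k ⊓ copWinsValue))) i
  correct 0 _ = refl
  correct 1 _ = trans (m∸[m∸n]≡m⊓n (solved 1) copWinsValue)
    (cong (_⊓ copWinsValue) (solved-intact (topCell>5 I (s≤s (s≤s z≤n)))))
  correct 2 _ = refl
  correct 3 _ = refl
  correct 4 _ = refl
  correct 5 _ = refl
  correct (suc (suc (suc (suc (suc (suc i)))))) (s≤s (s≤s (s≤s (s≤s (s≤s (s≤s ()))))))

kernelize-correct : ∀ I → let open Input I; m = exec N [] kernelize m₀; ys = encodeCops (reduction I) in
  m topCell ≡ length ys × (∀ i → i < length ys → m i ≡ cells ys i)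
kernelize-correct I with CopsInstance.k I ∸ 1
... | zero  = toEdge-correct I
... | suc _ = Restrict.final-length I , Restrict.final-correct I

bits≥1 : ∀ n → 1 ≤ bits n
bits≥1 n = s≤s z≤n

length≤size : ∀ xs → length xs ≤ size xs
length≤size []       = z≤n
length≤size (x ∷ xs) = +-mono-≤ (bits≥1 x) (length≤size xs)

order<size : ∀ I → CopsInstance.order I < size (encodeCops I)
order<size I = begin
  suc N                   ≤⟨ s≤s (m≤n*n N) ⟩
  1 + N * N               ≤⟨ n≤1+n _ ⟩
  2 + N * N               ≡⟨ topCell≡ ⟨
  topCell                 ≡⟨ length-encode ⟨
  length (encodeCops I)   ≤⟨ length≤size (encodeCops I) ⟩
  size (encodeCops I)     ∎
  where
  open ≤-Reasoning
  open Input I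
  m≤n*n : ∀ n → n ≤ n * n
  m≤n*n zero      = z≤n
  m≤n*n n@(suc _) = m≤m*n n n

polyTime-reduction : PolyTime encodeCops encodeCops reduction
polyTime-reduction = polyTime {encA = encodeCops} {encodeCops} {reduction} kernelize (cell top) λ I → order<size I , kernelize-correct I

reduction-equivalent : ∀ I → let open CopsInstance in
  Game.CopWin (graph I) (k I) ⇔ Game.CopWin (graph (reduction I)) (k (reduction I))
reduction-equivalent record { k = suc (suc k) ; graph = G ; connected = conn ; hasEdge = edge } =
  copwin-⊓ (Domination.keptGraph G) (suc (suc k)) (proj₁ (Domination.keptGraph-hasEdge G edge)) ⇔-∘
  Domination.retract-copwin G conn
reduction-equivalent record { k = zero ; graph = G ; hasEdge = edge } =
  mk⇔ (λ w → contradiction w (no-cops G (proj₁ edge))) (λ w → contradiction w (no-cops edgeGraph zero))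
reduction-equivalent I@(record { k = suc zero })
  with Input.copWinsValue I | Input.decides-copWins I
... | zero  | d = mk⇔ (λ w → contradiction (complete d w) λ ()) (λ w → contradiction w (no-cops edgeGraph zero))
... | suc _ | d = mk⇔ (λ _ → edgeGraph-copwin) (λ _ → sound d z<s)

-- Bounds on the order and the encoded size of the kernel

n<2^n : ∀ n → n < 2 ^ n
n<2^n zero    = z<s
n<2^n (suc n) = +-mono-≤ (≤-<-trans z≤n (n<2^n n)) (≤-trans (n<2^n n) (m≤m+n _ 0))

reduction-order : ∀ I → CopsInstance.order (reduction I) ≤ kernelBound (CopsInstance.vcn I)
reduction-order I with CopsInstance.k I ∸ 1
... | suc _ = Domination.keptGraph-order (CopsInstance.graph I) (CopsInstance.hasEdge I)
-- The two vertices of the edge are counted as 1 + 1, at most `p + 1`, so the estimate is needed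
-- only for an antichain of one member.
... | zero  = ≤-trans (+-monoˡ-≤ 1 0<p) (p+m≤kernelBound 0<p (begin
  1 * 1 * p    ≡⟨ *-identityˡ p ⟩
  p            ≤⟨ <⇒≤ (n<2^n p) ⟩
  2 ^ p        ≤⟨ ^-monoˡ-≤ p (s≤s (s≤s z≤n)) ⟩
  4 ^ p        ∎))
  where
  open ≤-Reasoning
  p = CopsInstance.vcn I
  0<p : 0 < p
  0<p = Domination.vcn-positive (CopsInstance.graph I) (CopsInstance.hasEdge I)

-- The encoding also spends bits on the number of cops, which thereby becomes bounded in the
-- parameter.
reduction-k : ∀ I → CopsInstance.k (reduction I) ≤ CopsInstance.order (reduction I)
reduction-k I with CopsInstance.k I ∸ 1 in eq
... | zero  = ≤-trans (m⊓n≤m (CopsInstance.k I) (Input.copWinsValue I)) (≤-trans (m∸n≡0⇒m≤n eq) (s≤s z≤n))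
... | suc _ = m⊓n≤n (CopsInstance.k I) (Graph.order (Domination.keptGraph (CopsInstance.graph I)))

bits≤ : ∀ n → bits n ≤ suc n
bits≤ n = s≤s (subst (⌊log₂ n ⌋ ≤_) (⌊log₂[2^n]⌋≡n n) (⌊log₂⌋-mono-≤ (<⇒≤ (n<2^n n))))

size-ones : ∀ {xs} → All (λ x → bits x ≡ 1) xs → size xs ≡ length xs
size-ones []       = refl
size-ones (p ∷ ps) = cong₂ _+_ p (size-ones ps)

size-encode : ∀ I → let open CopsInstance I in size (encodeCops I) ≤ suc order + (suc k + order * order)
size-encode I = +-mono-≤ (bits≤ N) (+-mono-≤ (bits≤ k) (≤-reflexive (begin
  size (concatMap row (allFin N))     ≡⟨ size-ones (concat⁺ (map⁺ (All.universal (λ u → map⁺ (All.universal (entry-bits u) _)) (allFin N)))) ⟩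
  length (concatMap row (allFin N))   ≡⟨ length-concatMap (λ i → i) row length-row ⟩
  N * N                               ∎)))
  where
  open ≡-Reasoning
  open Input I
  open CopsInstance I
  entry-bits : ∀ u v → bits (entry u v) ≡ 1
  entry-bits u v with does (Adj? u v)
  ... | true  = refl
  ... | false = refl

-- With x = 2^p the order is at most 2x, and the word takes at most 4x² + 4x + 2 ≤ 10x² bits. The
-- constant is rounded up to 16, so that the bound is computed by repeated quadrupling.
sizeBound : ℕ → ℕ
sizeBound p = 16 * 4 ^ p

reduction-size : ∀ I → size (encodeCops (reduction I)) ≤ sizeBound (CopsInstance.vcn I)
reduction-size I = begin
  size (encodeCops (reduction I))   ≤⟨ size-encode (reduction I) ⟩
  suc n + (suc k + n * n)           ≤⟨ +-monoʳ-≤ (suc n) (+-monoˡ-≤ (n * n) (s≤s (reduction-k I))) ⟩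
  suc n + (suc n + n * n)           ≤⟨ +-mono-≤ (s≤s n≤2x) (+-mono-≤ (s≤s n≤2x) (*-mono-≤ n≤2x n≤2x)) ⟩
  suc (2 * x) + (suc (2 * x) + 2 * x * (2 * x))   ≡⟨ expand x ⟩
  4 * (x * x) + (4 * (1 * x) + 2 * (1 * 1))   ≤⟨ +-monoʳ-≤ (4 * (x * x)) (+-mono-≤ (*-monoʳ-≤ 4 (*-monoˡ-≤ x 1≤x)) (*-monoʳ-≤ 2 (*-mono-≤ 1≤x 1≤x))) ⟩
  4 * (x * x) + (4 * (x * x) + 2 * (x * x))   ≤⟨ m≤m+n _ (6 * (x * x)) ⟩
  4 * (x * x) + (4 * (x * x) + 2 * (x * x)) + 6 * (x * x)   ≡⟨ collect (x * x) ⟩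
  16 * (x * x)                      ≡⟨ cong (16 *_) (4^p≡2^p*2^p p) ⟨
  16 * 4 ^ p                        ∎
  where
  open ≤-Reasoning
  open CopsInstance (reduction I) using (k) renaming (order to n)
  p = CopsInstance.vcn I
  x = 2 ^ p
  1≤x : 1 ≤ x
  1≤x = m^n>0 2 p
  n≤2x : n ≤ 2 * x
  n≤2x = ≤-trans (reduction-order I) (≤-trans (kernelBound≤ p)
    (+-mono-≤ (<⇒≤ (n<2^n p)) (≤-reflexive (sym (+-identityʳ x)))))
  expand : ∀ x → suc (2 * x) + (suc (2 * x) + 2 * x * (2 * x)) ≡ 4 * (x * x) + (4 * (1 * x) + 2 * (1 * 1))
  expand = solve-∀
  collect : ∀ y → 4 * y + (4 * y + 2 * y) + 6 * y ≡ 16 * y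
  collect = solve-∀

-- The input word consists of the argument alone, so `N` is the argument and the loop quadruples
-- that many times.
computeSizeBound : Stmt 0
computeSizeBound =
  lit 0 := lit 16 ⨟
  -- The trailing `lit 0` makes the value unfold to exactly `4 * m 0`.
  for (lit 0 := cell (lit 0) ⊕ (cell (lit 0) ⊕ (cell (lit 0) ⊕ (cell (lit 0) ⊕ lit 0))))

sizeBound-computable : Computable sizeBound
sizeBound-computable = compile computeSizeBound (lit 1) , λ n →
  let t , run , _ = compile-correct computeSizeBound (lit 1) [ n ] [ sizeBound n ] refl (correct n)
  in t , run
  where
  iterate : ℕ → Memory → Memory
  iterate n = iter n λ _ m → m [ 0 ≔ 4 * m 0 ]
  value : ∀ n m → iterate n m 0 ≡ m 0 * 4 ^ n
  value zero    m = sym (*-identityʳ (m 0))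
  value (suc n) m = trans (cong (4 *_) (value n m)) (shuffle (m 0) (4 ^ n))
    where shuffle : ∀ x y → 4 * (x * y) ≡ x * (4 * y)
          shuffle = solve-∀
  correct : ∀ n i → i < 1 → exec n [] computeSizeBound (cells [ n ]) i ≡ cells [ sizeBound n ] i
  correct n zero    _        = value n (cells [ n ] [ 0 ≔ 16 ])
  correct n (suc i) (s≤s ())

theorem2 : Σ (Kernel CopsAndRobber) λ K →
    (I : CopsInstance) → CopsInstance.order (Kernel.reduce K I) ≤ kernelBound (CopsInstance.vcn I)
theorem2 = record
  { reduce     = reduction
  ; polyTime   = polyTime-reduction
  ; equivalent = reduction-equivalent
  ; bound      = sizeBound
  ; computable = sizeBound-computable
  ; bounded    = reduction-size
  } , reduction-order
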